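{- Let $r\ge1$ be an integer. Let $(p,l)$ be an irregular pair with $\Delta_{(p,l)}\neq0$, and let $(p,l_r)\in\Psi^{\rm irr}_r$ be the (unique) irregular pair of order $r$ corresponding to $(p,l)$, with associated pair $(p,s_1,\ldots,s_r)\in\widehat{\Psi}^{\rm irr}_r$. For even $m\ge2$ put $Q(m)=\operatorname{num}\!\left(\frac{B_m}{m}\right)\Big/\operatorname{num}\!\left(\frac{B_m}{m(m-1)}\right)$ and define \[ A(p^r)=\min_{k\in\mathbb{N}_0}\left\{\, m=l_r+k\varphi(p^r) \;:\; Q(m)=p^r \,\right\}. \] Then $A(p^r)$ has a solution only if $(p,s_1,s_2,\ldots,s_r)=(p,l,l-1,\ldots,l-1)$ and $l_r-1=(l-1)p^{r-1}$. Furthermore, $A(p^r)=(l_r-1)p+1=(l-1)p^r+1$ holds, and is the smallest possible value, if and only if one of the following cases holds: (1) $l-1$ has no irregular prime factors; (2) if $q$ is an irregular prime divisor of $l-1$, then all irregular pairs $(q,l')$ satisfy $(l-1)p^r\not\equiv l'-1 \pmod{q-1}$.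
   Context: $B_n$ denotes the $n$-th Bernoulli number ($\frac{z}{e^z-1}=\sum_{n\ge0}B_n\frac{z^n}{n!}$); $\operatorname{num}(r)$ is the numerator of a rational number $r$ in lowest terms; $\varphi$ is Euler's function. For an odd prime $p$, $(p,l)$ is an irregular pair if $l$ is even, $2\le l\le p-3$ and $p\mid B_l$; a prime is irregular if it has an irregular pair. For $n\ge1$, $(p,l)$ is an irregular pair of order $n$ if $l$ is even, $2\le l<\varphi(p^n)$ and $p^n\mid B_l/l$ (divides the numerator); the set of these is $\Psi^{\rm irr}_n$. For $(p,l)\in\Psi^{\rm irr}_n$ write $l=\sum_{\nu=1}^n s_\nu\varphi(p^{\nu-1})$ with $0\le s_\nu<p$ (and $s_1$ even, $2\le s_1\le p-3$); then $(p,s_1,\ldots,s_n)$ is the associated pair and the set of these is $\widehat{\Psi}^{\rm irr}_n$. For an irregular pair $(p,l)$, $\Delta_{(p,l)}$ is the integer in $[0,p)$ with $\Delta_{(p,l)}\equiv p^{ -1}\left(\frac{B_{l+\varphi(p)}}{l+\varphi(p)}-\frac{B_l}{l}\right)\pmod p$. Known fact (from earlier work): if $\Delta_{(p,l)}\neq0$, then for each $n\ge1$ there is exactly one irregular pair of order $n$ corresponding to $(p,l)$, i.e. a unique sequence $(s_\nu)_{\nu\ge1}$ with $s_1=l$ and $(p,s_1,\ldots,s_n)\in\widehat{\Psi}^{\rm irr}_n$ for all $n$; $l_n$ denotes $\sum_{\nu=1}^n s_\nu\varphi(p^{\nu-1})$.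
   Formalization: The "if and only if" is stated under the condition of the first sentence, (s_1,…,s_r)=(l,l-1,…,l-1) and l_r-1=(l-1)p^{r-1}; without it the claim fails, e.g. for p=37, l=32, r=2, where s_2=7 but 31 has no irregular prime factor. -}

module Defs where

open import Data.Integer.Base using (+_)
open import Data.Integer.Divisibility using () renaming (_∣_ to _∣ℤ_)
open import Data.List.Base using (length; filter; applyUpTo)
open import Data.Nat.Base as ℕ using (ℕ; zero; suc; _∸_; _^_; _≤_; _<_; _!; ∣_-_∣; z≤n; s≤s)
open import Data.Nat.Combinatorics using (_C_; nCk≡n!/k![n-k]!; [n∸k]!k!∣n!; nCk≡nC[n∸k]; nC1≡n)
open import Data.Nat.Coprimality using (coprime?)
open import Data.Nat.Divisibility using (_∣_; ∣-trans; ∣-reflexive)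
open import Data.Nat.DivMod using (m/n*n≡m)
open import Data.Nat.Primality using (Prime)
open import Data.Fin.Base using (toℕ)
open import Data.Product.Base using (∃-syntax; _×_)
open import Data.Rational.Base using (ℚ; 0ℚ; 1ℚ; _+_; _*_; _-_; -_; _÷_; _/_; 1/_; ↥_; ≢-nonZero; toℚᵘ)
open import Data.Rational.Properties using (_≟_)
open import Data.Vec.Base as Vec using (Vec; []; _∷_; head; lookup; tabulate)
open import Relation.Binary.PropositionalEquality
open import Relation.Nullary using (¬_; yes; no; contradiction)

import Data.Integer.Base as ℤ
import Data.Integer.Properties as ℤₚ
import Data.Nat.Properties as ℕₚ
import Data.Rational.Properties as ℚₚ
import Data.Rational.Unnormalised.Base as ℚᵘ

ι : ℕ → ℚ
ι n = + n / 1

-- Division made total by x / 0 = 0.  The value at 0 is never used below when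
-- the arguments are as in the mathematics: all divisors are positive integers,
-- or (in Q) the numerator of a nonzero rational.
infixl 7 _÷₀_
_÷₀_ : ℚ → ℚ → ℚ
x ÷₀ y with y ≟ 0ℚ
... | yes _  = 0ℚ
... | no y≢0 = _÷_ x y {{≢-nonZero y≢0}}

Σ< : ℕ → (ℕ → ℚ) → ℚ
Σ< zero    f = 0ℚ
Σ< (suc n) f = Σ< n f + f n

-- Bernoulli numbers, via  B₀ = 1,  Σ_{k ≤ n} C(n+1,k) Bₖ = 0  for n ≥ 1.
-- The vector  bernoullis n  is  Bₙ₋₁ ∷ ⋯ ∷ B₀ ∷ [] , and  weightedSum c
-- applied to it is  Σ_{k < n} c k * Bₖ .

weightedSum : ∀ {n} → (ℕ → ℚ) → Vec ℚ n → ℚ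
weightedSum c []               = 0ℚ
weightedSum c (_∷_ {n} x xs) = weightedSum c xs + c n * x

nextBernoulli : ∀ n → Vec ℚ n → ℚ
nextBernoulli zero      _  = 1ℚ
nextBernoulli n@(suc _) bs = - (weightedSum (λ k → ι (suc n C k)) bs ÷₀ ι (suc n))

bernoullis : ∀ n → Vec ℚ n
bernoullis zero    = []
bernoullis (suc n) = nextBernoulli n (bernoullis n) ∷ bernoullis n

B : ℕ → ℚ
B n = head (bernoullis (suc n))

-- Formal power series over ℚ, as coefficient sequences.

infixl 7 _⊛_
_⊛_ : (ℕ → ℚ) → (ℕ → ℚ) → ℕ → ℚ
(f ⊛ g) n = Σ< (suc n) (λ k → f k * g (n ∸ k))

egf : (ℕ → ℚ) → ℕ → ℚ
egf a n = a n ÷₀ ι (n !)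

[e^z-1] : ℕ → ℚ
[e^z-1] = egf λ { zero → 0ℚ ; (suc _) → 1ℚ }

[z] : ℕ → ℚ
[z] 1 = 1ℚ
[z] _ = 0ℚ

private
  ι-* : ∀ m n → ι (m ℕ.* n) ≡ ι m * ι n
  ι-* m n = sym (ℚₚ.toℚᵘ-injective (begin
    toℚᵘ (ι m * ι n)                        ≈⟨ ℚₚ.toℚᵘ-homo-* (ι m) (ι n) ⟩
    toℚᵘ (ι m) ℚᵘ.* toℚᵘ (ι n)              ≈⟨ ℚᵘₚ.*-cong (ℚₚ.toℚᵘ-fromℚᵘ (m′ m)) (ℚₚ.toℚᵘ-fromℚᵘ (m′ n)) ⟩
    m′ m ℚᵘ.* m′ n                          ≈⟨ ℚᵘ.*≡* (cong (ℤ._* + 1) (sym (ℤₚ.pos-* m n))) ⟩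
    m′ (m ℕ.* n)                            ≈⟨ ℚₚ.toℚᵘ-fromℚᵘ (m′ (m ℕ.* n)) ⟨
    toℚᵘ (ι (m ℕ.* n))                      ∎))
    where
    import Data.Rational.Unnormalised.Properties as ℚᵘₚ
    open ℚᵘₚ.≃-Reasoning
    m′ : ℕ → ℚᵘ.ℚᵘ
    m′ k = ℚᵘ.mkℚᵘ (+ k) 0

  ι≢0 : ∀ n .{{_ : ℕ.NonZero n}} → ι n ≢ 0ℚ
  ι≢0 (suc n) eq with ℚₚ.fromℚᵘ-injective {ℚᵘ.mkℚᵘ (+ suc n) 0} {ℚᵘ.0ℚᵘ} eq
  ... | ℚᵘ.*≡* ()

  ÷₀-* : ∀ x {y} → y ≢ 0ℚ → (x ÷₀ y) * y ≡ x
  ÷₀-* x {y} y≢0 with y ≟ 0ℚ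
  ... | yes y≡0 = contradiction y≡0 y≢0
  ... | no  y≢0 = begin
    x * 1/ y * y    ≡⟨ ℚₚ.*-assoc x (1/ y) y ⟩
    x * (1/ y * y)  ≡⟨ cong (x *_) (ℚₚ.*-inverseˡ y) ⟩
    x * 1ℚ          ≡⟨ ℚₚ.*-identityʳ x ⟩
    x               ∎
    where
    open ≡-Reasoning
    instance _ = ≢-nonZero y≢0

  *-÷₀ : ∀ x {y} → y ≢ 0ℚ → (x * y) ÷₀ y ≡ x
  *-÷₀ x {y} y≢0 with y ≟ 0ℚ
  ... | yes y≡0 = contradiction y≡0 y≢0
  ... | no  y≢0 = begin
    x * y * 1/ y    ≡⟨ ℚₚ.*-assoc x y (1/ y) ⟩
    x * (y * 1/ y)  ≡⟨ cong (x *_) (ℚₚ.*-inverseʳ y) ⟩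
    x * 1ℚ          ≡⟨ ℚₚ.*-identityʳ x ⟩
    x               ∎
    where
    open ≡-Reasoning
    instance _ = ≢-nonZero y≢0

  +-÷₀ : ∀ x x′ {y} → y ≢ 0ℚ → x ÷₀ y + x′ ÷₀ y ≡ (x + x′) ÷₀ y
  +-÷₀ x x′ {y} y≢0 = begin
    x ÷₀ y + x′ ÷₀ y               ≡⟨ *-÷₀ _ y≢0 ⟨
    ((x ÷₀ y + x′ ÷₀ y) * y) ÷₀ y  ≡⟨ cong (_÷₀ y) (ℚₚ.*-distribʳ-+ y (x ÷₀ y) (x′ ÷₀ y)) ⟩
    (x ÷₀ y * y + x′ ÷₀ y * y) ÷₀ y ≡⟨ cong (_÷₀ y) (cong₂ _+_ (÷₀-* x y≢0) (÷₀-* x′ y≢0)) ⟩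
    (x + x′) ÷₀ y                  ∎
    where open ≡-Reasoning

  0÷₀ : ∀ {y} → y ≢ 0ℚ → 0ℚ ÷₀ y ≡ 0ℚ
  0÷₀ {y} y≢0 = trans (cong (_÷₀ y) (sym (ℚₚ.*-zeroˡ y))) (*-÷₀ 0ℚ y≢0)

  !≢0 : ∀ n → ι (n !) ≢ 0ℚ
  !≢0 n = ι≢0 (n !) {{n ℕₚ.!≢0}}

  C*k!*[n∸k]! : ∀ {n k} → k ≤ n → (n C k) ℕ.* (k ! ℕ.* (n ∸ k) !) ≡ n !
  C*k!*[n∸k]! {n} {k} k≤n = begin
    (n C k) ℕ.* d                 ≡⟨ cong (ℕ._* d) (nCk≡n!/k![n-k]! k≤n) ⟩
    (n ! ℕ./ d) ℕ.* d           ≡⟨ m/n*n≡m (∣-trans (∣-reflexive (ℕₚ.*-comm (k !) ((n ∸ k) !))) ([n∸k]!k!∣n! k≤n)) ⟩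
    n !                         ∎
    where
    open ≡-Reasoning
    d = k ! ℕ.* (n ∸ k) !
    instance _ = k ℕₚ.!* (n ∸ k) !≢0

  egf-term : ∀ x y {n k} → k ≤ n →
             (x ÷₀ ι (k !)) * (y ÷₀ ι ((n ∸ k) !)) ≡ (ι (n C k) * x * y) ÷₀ ι (n !)
  egf-term x y {n} {k} k≤n = begin
    u * v                                          ≡⟨ *-÷₀ (u * v) (!≢0 n) ⟨
    (u * v * ι (n !)) ÷₀ ι (n !)                   ≡⟨ cong (_÷₀ ι (n !)) eq ⟩
    (ι (n C k) * x * y) ÷₀ ι (n !)                 ∎
    where
    open ≡-Reasoning
    open import Data.Rational.Solver using (module +-*-Solver)
    open +-*-Solver
    u = x ÷₀ ι (k !)
    v = y ÷₀ ι ((n ∸ k) !)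
    c = ι (n C k)
    eq : u * v * ι (n !) ≡ c * x * y
    eq = begin
      u * v * ι (n !)
        ≡⟨ cong (λ t → u * v * ι t) (C*k!*[n∸k]! k≤n) ⟨
      u * v * ι ((n C k) ℕ.* (k ! ℕ.* (n ∸ k) !))
        ≡⟨ cong (u * v *_) (trans (ι-* (n C k) _) (cong (c *_) (ι-* (k !) _))) ⟩
      u * v * (c * (ι (k !) * ι ((n ∸ k) !)))
        ≡⟨ solve 5 (λ u v c a b → u :* v :* (c :* (a :* b)) := c :* (u :* a) :* (v :* b)) refl u v c _ _ ⟩
      c * (u * ι (k !)) * (v * ι ((n ∸ k) !))
        ≡⟨ cong₂ (λ s t → c * s * t) (÷₀-* x (!≢0 k)) (÷₀-* y (!≢0 (n ∸ k))) ⟩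
      c * x * y ∎

  weightedSum≡Σ< : ∀ c n → weightedSum c (bernoullis n) ≡ Σ< n (λ k → c k * B k)
  weightedSum≡Σ< c zero    = refl
  weightedSum≡Σ< c (suc n) = cong (_+ c n * B n) (weightedSum≡Σ< c n)

bernoulli-recurrence : ∀ n → Σ< (2 ℕ.+ n) (λ k → ι ((2 ℕ.+ n) C k) * B k) ≡ 0ℚ
bernoulli-recurrence n′ = begin
  S + ι (suc n C n) * B n              ≡⟨ cong (λ t → S + ι t * B n) C≡ ⟩
  S + ι (suc n) * B n                  ≡⟨ cong (λ t → S + ι (suc n) * - (t ÷₀ ι (suc n))) (weightedSum≡Σ< _ n) ⟩
  S + ι (suc n) * - (S ÷₀ ι (suc n))   ≡⟨ cong (λ t → S + t) (trans (ℚₚ.*-comm (ι (suc n)) _) (sym (ℚₚ.neg-distribˡ-* (S ÷₀ ι (suc n)) (ι (suc n))))) ⟩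
  S + - (S ÷₀ ι (suc n) * ι (suc n))   ≡⟨ cong (λ t → S + - t) (÷₀-* S (ι≢0 (suc n))) ⟩
  S + - S                              ≡⟨ ℚₚ.+-inverseʳ S ⟩
  0ℚ                                   ∎
  where
  open ≡-Reasoning
  n = suc n′
  S = Σ< n (λ k → ι (suc n C k) * B k)
  C≡ : suc n C n ≡ suc n
  C≡ = trans (nCk≡nC[n∸k] (ℕₚ.n≤1+n n))
      (trans (cong (suc n C_) (ℕₚ.m+n∸n≡m 1 n)) (nC1≡n (suc n)))

-- (Σ Bₙ zⁿ / n!) · (e^z - 1) = z
bernoulli-generatingFunction : ∀ n → (egf B ⊛ [e^z-1]) n ≡ [z] n
bernoulli-generatingFunction zero    = refl
bernoulli-generatingFunction (suc n) = begin
  Σ< (suc n) t + t (suc n)                          ≡⟨ cong (λ x → Σ< (suc n) t + x) last≡0 ⟩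
  Σ< (suc n) t + 0ℚ                                 ≡⟨ ℚₚ.+-identityʳ _ ⟩
  Σ< (suc n) t                                      ≡⟨ sum≡ (suc n) ℕₚ.≤-refl ⟩
  Σ< (suc n) (λ k → ι (suc n C k) * B k) ÷₀ ι (suc n !)  ≡⟨ final n ⟩
  [z] (suc n)                                       ∎
  where
  open ≡-Reasoning
  t : ℕ → ℚ
  t k = egf B k * [e^z-1] (suc n ∸ k)

  last≡0 : t (suc n) ≡ 0ℚ
  last≡0 = trans (cong (λ j → egf B (suc n) * [e^z-1] j) (ℕₚ.n∸n≡0 n)) (ℚₚ.*-zeroʳ (egf B (suc n)))

  term : ∀ k → k ≤ n → t k ≡ (ι (suc n C k) * B k) ÷₀ ι (suc n !)
  term k k≤n = begin
    egf B k * [e^z-1] (suc n ∸ k)                   ≡⟨ cong (egf B k *_) exp≡ ⟩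
    egf B k * (1ℚ ÷₀ ι ((suc n ∸ k) !))             ≡⟨ egf-term (B k) 1ℚ (ℕₚ.m≤n⇒m≤1+n k≤n) ⟩
    (ι (suc n C k) * B k * 1ℚ) ÷₀ ι (suc n !)       ≡⟨ cong (_÷₀ ι (suc n !)) (ℚₚ.*-identityʳ _) ⟩
    (ι (suc n C k) * B k) ÷₀ ι (suc n !)            ∎
    where
    exp≡ : [e^z-1] (suc n ∸ k) ≡ 1ℚ ÷₀ ι ((suc n ∸ k) !)
    exp≡ rewrite ℕₚ.+-∸-assoc 1 k≤n = refl

  sum≡ : ∀ m → m ≤ suc n → Σ< m t ≡ Σ< m (λ k → ι (suc n C k) * B k) ÷₀ ι (suc n !)
  sum≡ zero    _         = sym (0÷₀ (!≢0 (suc n)))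
  sum≡ (suc m) (s≤s m≤n) =
    trans (cong₂ _+_ (sum≡ m (ℕₚ.m≤n⇒m≤1+n m≤n)) (term m m≤n)) (+-÷₀ _ _ (!≢0 (suc n)))

  final : ∀ n → Σ< (suc n) (λ k → ι (suc n C k) * B k) ÷₀ ι (suc n !) ≡ [z] (suc n)
  final zero    = refl
  final (suc n) = trans (cong (_÷₀ ι (suc (suc n) !)) (bernoulli-recurrence n)) (0÷₀ (!≢0 (suc (suc n))))

-- ↥ is the numerator in lowest terms, since ℚ is kept normalised.
infix 4 _∣num_
_∣num_ : ℕ → ℚ → Set
n ∣num x = + n ∣ℤ ↥ x

B/ : ℕ → ℚ
B/ m = B m ÷₀ ι m

φ : ℕ → ℕ
φ n = length (filter (coprime? n) (applyUpTo suc n))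

infix 4 _≡_[mod_] _≡ℚ_[mod_]
_≡_[mod_] : ℕ → ℕ → ℕ → Set
a ≡ b [mod n ] = n ∣ ∣ a - b ∣

-- Meant for n prime: the lowest-terms numerator of x - y being
-- divisible by n says that x - y lies in n times the n-integral rationals.
_≡ℚ_[mod_] : ℚ → ℚ → ℕ → Set
x ≡ℚ y [mod n ] = n ∣num (x - y)

OddPrime : ℕ → Set
OddPrime p = Prime p × ¬ (2 ∣ p)

record IrregularPair (p l : ℕ) : Set where
  field
    oddPrime : OddPrime p
    even     : 2 ∣ l
    lower    : 2 ≤ l
    upper    : l ≤ p ∸ 3
    divides  : p ∣num B l

Irregular : ℕ → Set
Irregular p = ∃[ l ] IrregularPair p l

-- (p , l) ∈ Ψ^irr_n
record IrregularPairOfOrder (n p l : ℕ) : Set where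
  field
    oddPrime : OddPrime p
    order    : 1 ≤ n
    even     : 2 ∣ l
    lower    : 2 ≤ l
    upper    : l < φ (p ^ n)
    divides  : p ^ n ∣num B/ l

-- With s = (s₁ , … , sₙ):  Σ_{ν=1}^n s_ν φ(p^{ν-1}), where i = ν - 1.
expand : ∀ (p : ℕ) {n} → Vec ℕ n → ℕ
expand p s = Vec.sum (tabulate λ i → lookup s i ℕ.* φ (p ^ toℕ i))

-- (p , s₁ , … , sₙ) ∈ Ψ̂^irr_n is the pair associated with (p , l) ∈ Ψ^irr_n
-- (n = suc n′).
record AssociatedPair (p l : ℕ) {n′ : ℕ} (s : Vec ℕ (suc n′)) : Set where
  field
    pair      : IrregularPairOfOrder (suc n′) p l
    expansion : l ≡ expand p s
    digits    : ∀ i → lookup s i < p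
    s₁-even   : 2 ∣ head s
    s₁-lower  : 2 ≤ head s
    s₁-upper  : head s ≤ p ∸ 3

-- Δ is the integer Δ_{(p,l)}.
IsΔ : (p l Δ : ℕ) → Set
IsΔ p l Δ = Δ < p × ι Δ ≡ℚ (B/ (l ℕ.+ φ p) - B/ l) ÷₀ ι p [mod p ]

Q : ℕ → ℚ
Q m = (↥ B/ m / 1) ÷₀ (↥ (B m ÷₀ ι (m ℕ.* (m ∸ 1))) / 1)

-- The set of which A(p^r) is the minimum.
ASet : (p r lᵣ m : ℕ) → Set
ASet p r lᵣ m = (∃[ k ] m ≡ lᵣ ℕ.+ k ℕ.* φ (p ^ r)) × Q m ≡ ι (p ^ r)

-- A(p^r) exists and equals a.
IsA : (p r lᵣ a : ℕ) → Set
IsA p r lᵣ a = ASet p r lᵣ a × (∀ m → ASet p r lᵣ m → a ≤ m)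

NoIrregularPrimeFactors : ℕ → Set
NoIrregularPrimeFactors n = ∀ q → Irregular q → ¬ (q ∣ n)

{-# OPTIONS --safe #-}

-- Q(m) is the greatest common divisor of num(B_m/m) and m - 1.  Hence Q(m) = p^r
-- forces p^r ∣ m - 1, so p^(r-1) ∣ l_r - 1, which fixes the digits of l_r; the same
-- divisibility shows that every solution is at least M = (l-1)p^r + 1.  By Kummer's
-- congruence p^r divides B_M/M, so Q(M) = p^r means that no prime q ∣ l - 1 divides
-- num(B_M/M).  Such q is odd; it does not divide when q - 1 ∣ M (von Staudt), and
-- otherwise it does exactly when M is congruent mod q - 1 to some l' with (q,l')
-- irregular (Kummer mod q).
--
-- Both congruences come from (1 - a^(n+1)) B_(n+1)/(n+1), whose exponential generating
-- function 1/(e^z - 1) - a/(e^(az) - 1) is G(e^z)/[a](e^z), where [a](x) = 1 + ⋯ + x^(a-1)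
-- and G(x) = ([a](x) - a)/(x - 1) has integer coefficients.  For p ∤ a the factor [a]
-- can be inverted (x - 1)-adically over ℤ₍ₚ₎, so up to any given n this sequence is a
-- ℤ₍ₚ₎-linear combination of power sequences iⁿ, for which Euler's theorem applies.

module Submission where

open import Defs
import Data.Integer.Base as ℤ
import Data.Integer.Properties as ℤₚ
import Data.Nat.Base as ℕ
import Data.Nat.Coprimality as Coprimality
import Data.Nat.DivMod as ℕ/
import Data.Nat.Properties as ℕₚ
import Data.Rational.Properties as ℚₚ
import Data.Rational.Unnormalised.Base as ℚᵘ
import Data.Rational.Unnormalised.Properties as ℚᵘₚ
open import Data.Fin.Base using (toℕ) renaming (zero to fzero; suc to fsuc)
open import Data.Integer.Base using (ℤ)
open import Data.List.Base using (length; filter; applyUpTo; []; _∷_; _∷ʳ_; _++_)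
open import Data.List.Properties using (length-++; filter-++; filter-accept; filter-reject; applyUpTo-∷ʳ)
open import Data.List.Relation.Unary.All using (_∷_)
open import Data.Nat.Base using (zero; z≤n; s≤s; _<_; ∣_-_∣)
open import Data.Nat.Coprimality using (Coprime; coprime?; recompute; coprime-divisor)
open import Data.Nat.Divisibility
open import Data.Nat.Primality
open import Data.Nat.Primality.Factorisation using (factorise)
open import Data.Nat.Solver using () renaming (module +-*-Solver to ℕ-Solver)
open import Data.Product.Base using (∃-syntax; _,_; proj₁; proj₂)
open import Data.Rational.Base using (ℚ; ↥_)
open import Data.Sum.Base using (inj₁; inj₂; [_,_]′)
open import Data.Vec.Base as Vec using ([]; lookup; tabulate)
open import Data.Vec.Properties using (tabulate-cong)
open import Function.Base using (_∘_)
open import Function.Bundles using (mk⇔; Equivalence)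
open import Relation.Binary.PropositionalEquality
open import Relation.Nullary using (yes; no; contradiction)

-- The factor 1 - a^m serves two opposite ends. If p - 1 does not divide m, some a makes it a unit
-- at p, so divisibility of B_m/m by p^r can be read off the regularised sequence; such an a is
-- found without primitive roots, because Σ_{i<p} i^s vanishes mod p for s < p - 1. For von Staudt,
-- a = 1 + p is taken instead, and the factor contains p exactly once at m = p - 1. Only an
-- equivalence of two divisibilities is carried along a progression, so the factors at the two
-- indices are never compared with each other. Inverting [a](x) = a + (x - 1)G(x) produces an
-- infinite series in x - 1. Coefficient n of (e^z - 1)^j vanishes for j > n, so agreement with a
-- finite power sum is obtained up to a prescribed index only. No series is divided by e^z - 1:
-- identities are multiplied out and the factor is cancelled by injectivity. Q is a quotient with x
-- / 0 = 0, so the numerator of B_M/M has to be nonzero. This follows from the same prime-by-prime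
-- argument: l - 1 ≥ 2 has a prime factor, which would divide a zero numerator.

module _ where

  open import Data.Integer.Base using (∣_∣)
  open import Data.Nat.Base using (ℕ; suc; _∸_; _^_; _≤_; _!)
  open import Data.Nat.Combinatorics
    using (_C_; nCn≡1; nC1≡n; nCk≡nC[n∸k]; nCk+nC[k+1]≡[n+1]C[k+1]; k>n⇒nCk≡0; nCk≡n!/k![n-k]!; [n∸k]!k!∣n!)
  open import Data.Product.Base using (_×_)
  open import Data.Rational.Base
    using (0ℚ; 1ℚ; _+_; _*_; _-_; -_; _/_; 1/_; ↧_; ↧ₙ_; mkℚ; ≢-nonZero; toℚᵘ)
  open import Data.Rational.Solver using (module +-*-Solver)
  open import Function.Bundles using (_⇔_)
  open import Relation.Nullary using (¬_)
  open import Relation.Nullary.Decidable using (¬?; decidable-stable)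
  open +-*-Solver using (solve; _:=_; _:+_; _:*_; _:-_; :-_; con)

  -- Rational numbers and localisation at p

  fromℤ : ℤ → ℚ
  fromℤ k = k / 1

  private
    toℚᵘ-fromℤ : ∀ k → toℚᵘ (fromℤ k) ℚᵘ.≃ ℚᵘ.mkℚᵘ k 0
    toℚᵘ-fromℤ k = ℚₚ.toℚᵘ-fromℚᵘ (ℚᵘ.mkℚᵘ k 0)

  fromℤ-injective : ∀ i j → fromℤ i ≡ fromℤ j → i ≡ j
  fromℤ-injective i j eq with ℚₚ.fromℚᵘ-injective {ℚᵘ.mkℚᵘ i 0} {ℚᵘ.mkℚᵘ j 0} eq
  ... | ℚᵘ.*≡* e = trans (sym (ℤₚ.*-identityʳ i)) (trans e (ℤₚ.*-identityʳ j))

  fromℤ-+ : ∀ i j → fromℤ (i ℤ.+ j) ≡ fromℤ i + fromℤ j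
  fromℤ-+ i j = ℚₚ.toℚᵘ-injective (begin
    toℚᵘ (fromℤ (i ℤ.+ j))                  ≈⟨ toℚᵘ-fromℤ (i ℤ.+ j) ⟩
    ℚᵘ.mkℚᵘ (i ℤ.+ j) 0                     ≈⟨ ℚᵘ.*≡*
        (cong (ℤ._* ℤ.+ 1) (cong₂ ℤ._+_ (ℤₚ.*-identityʳ i) (ℤₚ.*-identityʳ j))) ⟨
    ℚᵘ.mkℚᵘ i 0 ℚᵘ.+ ℚᵘ.mkℚᵘ j 0            ≈⟨ ℚᵘₚ.+-cong (toℚᵘ-fromℤ i) (toℚᵘ-fromℤ j) ⟨
    toℚᵘ (fromℤ i) ℚᵘ.+ toℚᵘ (fromℤ j)      ≈⟨ ℚₚ.toℚᵘ-homo-+ (fromℤ i) (fromℤ j) ⟨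
    toℚᵘ (fromℤ i + fromℤ j)                ∎)
    where open ℚᵘₚ.≃-Reasoning

  fromℤ-* : ∀ i j → fromℤ (i ℤ.* j) ≡ fromℤ i * fromℤ j
  fromℤ-* i j = ℚₚ.toℚᵘ-injective (begin
    toℚᵘ (fromℤ (i ℤ.* j))                  ≈⟨ toℚᵘ-fromℤ (i ℤ.* j) ⟩
    ℚᵘ.mkℚᵘ i 0 ℚᵘ.* ℚᵘ.mkℚᵘ j 0            ≈⟨ ℚᵘₚ.*-cong (toℚᵘ-fromℤ i) (toℚᵘ-fromℤ j) ⟨
    toℚᵘ (fromℤ i) ℚᵘ.* toℚᵘ (fromℤ j)      ≈⟨ ℚₚ.toℚᵘ-homo-* (fromℤ i) (fromℤ j) ⟨
    toℚᵘ (fromℤ i * fromℤ j)                ∎)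
    where open ℚᵘₚ.≃-Reasoning

  ι-+ : ∀ m n → ι (m ℕ.+ n) ≡ ι m + ι n
  ι-+ m n = trans (cong fromℤ (ℤₚ.pos-+ m n)) (fromℤ-+ (ℤ.+ m) (ℤ.+ n))

  ι-* : ∀ m n → ι (m ℕ.* n) ≡ ι m * ι n
  ι-* m n = trans (cong fromℤ (ℤₚ.pos-* m n)) (fromℤ-* (ℤ.+ m) (ℤ.+ n))

  ι-suc : ∀ n → ι (suc n) ≡ 1ℚ + ι n
  ι-suc = ι-+ 1

  ι-injective : ∀ m n → ι m ≡ ι n → m ≡ n
  ι-injective m n eq = ℤₚ.+-injective (fromℤ-injective (ℤ.+ m) (ℤ.+ n) eq)

  ι≢0 : ∀ n → n ≢ 0 → ι n ≢ 0ℚ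
  ι≢0 n n≢0 eq = n≢0 (ι-injective n 0 eq)

  ι-suc≢0 : ∀ n → ι (suc n) ≢ 0ℚ
  ι-suc≢0 n = ι≢0 (suc n) λ ()

  *-÷₀ : ∀ x {y} → y ≢ 0ℚ → (x * y) ÷₀ y ≡ x
  *-÷₀ x {y} y≢0 with y ℚₚ.≟ 0ℚ
  ... | yes y≡0 = contradiction y≡0 y≢0
  ... | no  y≢0 = begin
    x * y * 1/ y    ≡⟨ ℚₚ.*-assoc x y (1/ y) ⟩
    x * (y * 1/ y)  ≡⟨ cong (x *_) (ℚₚ.*-inverseʳ y) ⟩
    x * 1ℚ          ≡⟨ ℚₚ.*-identityʳ x ⟩
    x               ∎
    where
    open ≡-Reasoning
    instance _ = ≢-nonZero y≢0

  ÷₀-* : ∀ x {y} → y ≢ 0ℚ → (x ÷₀ y) * y ≡ x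
  ÷₀-* x {y} y≢0 with y ℚₚ.≟ 0ℚ
  ... | yes y≡0 = contradiction y≡0 y≢0
  ... | no  y≢0 = begin
    x * 1/ y * y    ≡⟨ ℚₚ.*-assoc x (1/ y) y ⟩
    x * (1/ y * y)  ≡⟨ cong (x *_) (ℚₚ.*-inverseˡ y) ⟩
    x * 1ℚ          ≡⟨ ℚₚ.*-identityʳ x ⟩
    x               ∎
    where
    open ≡-Reasoning
    instance _ = ≢-nonZero y≢0

  *-cancelˡ : ∀ {x y z} → x ≢ 0ℚ → x * y ≡ x * z → y ≡ z
  *-cancelˡ {x} {y} {z} x≢0 eq = begin
    y            ≡⟨ *-÷₀ y x≢0 ⟨
    (y * x) ÷₀ x ≡⟨ cong (_÷₀ x) (trans (ℚₚ.*-comm y x) (trans eq (ℚₚ.*-comm x z))) ⟩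
    (z * x) ÷₀ x ≡⟨ *-÷₀ z x≢0 ⟩
    z            ∎
    where open ≡-Reasoning

  ↧*≡↥ : ∀ x → ι (↧ₙ x) * x ≡ fromℤ (↥ x)
  ↧*≡↥ x@record{} = ℚₚ.toℚᵘ-injective (begin
    toℚᵘ (ι (↧ₙ x) * x)             ≈⟨ ℚₚ.toℚᵘ-homo-* (ι (↧ₙ x)) x ⟩
    toℚᵘ (ι (↧ₙ x)) ℚᵘ.* toℚᵘ x     ≈⟨ ℚᵘₚ.*-cong (toℚᵘ-fromℤ (↧ x)) (ℚᵘₚ.≃-refl {toℚᵘ x}) ⟩
    ℚᵘ.mkℚᵘ (↧ x) 0 ℚᵘ.* toℚᵘ x     ≈⟨ ℚᵘ.*≡*
        (trans (ℤₚ.*-identityʳ _)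
            (trans (ℤₚ.*-comm (↧ x) (↥ x)) (cong (↥ x ℤ.*_) (sym (cong (λ k → ℤ.+ suc k) (ℕₚ.+-identityʳ _)))))) ⟩
    ℚᵘ.mkℚᵘ (↥ x) 0                 ≈⟨ toℚᵘ-fromℤ (↥ x) ⟨
    toℚᵘ (fromℤ (↥ x))              ∎)
    where open ℚᵘₚ.≃-Reasoning

  -- The fractional ideal nℤ₍ₚ₎ of the localisation of ℤ at the prime p.
  infix 4 _∈_ℤ₍_₎
  record _∈_ℤ₍_₎ (x : ℚ) (n p : ℕ) : Set where
    constructor fraction
    field
      denominator   : ℕ
      p∤denominator : ¬ (p ∣ denominator)
      quotient      : ℤ
      equation      : ι denominator * x ≡ ι n * fromℤ quotient

  ∣-prime-^ : ∀ {p} → Prime p → ∀ {a} r → p ∣ a ^ r → p ∣ a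
  ∣-prime-^ pr zero    p∣1 = contradiction (subst Prime (∣1⇒≡1 p∣1) pr) ¬prime[1]
  ∣-prime-^ pr {a} (suc r) p∣ with euclidsLemma a (a ^ r) pr p∣
  ... | inj₁ p∣a = p∣a
  ... | inj₂ p∣aʳ = ∣-prime-^ pr r p∣aʳ

  ∤⇒coprime : ∀ {p} → Prime p → ∀ {d} → ¬ (p ∣ d) → Coprime p d
  ∤⇒coprime pr p∤d {c} (c∣p , c∣d) with prime⇒irreducible pr c∣p
  ... | inj₁ c≡1 = c≡1
  ... | inj₂ c≡p = contradiction (subst (_∣ _) c≡p c∣d) p∤d

  ^-∣-cancel : ∀ {p} → Prime p → ∀ r {d n} → ¬ (p ∣ d) → p ^ r ∣ d ℕ.* n → p ^ r ∣ n
  ^-∣-cancel pr zero {n = n} p∤d _ = 1∣ n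
  ^-∣-cancel {p} pr (suc r) {d} {n} p∤d p^∣dn
    with coprime-divisor {p} {d} {n} (∤⇒coprime pr p∤d) (∣-trans (m∣m*n (p ^ r)) p^∣dn)
  ... | divides q refl = subst (p ^ suc r ∣_) (ℕₚ.*-comm p q) (*-monoʳ-∣ p (^-∣-cancel pr r p∤d
          (*-cancelˡ-∣ p {{prime⇒nonZero pr}} (subst (p ^ suc r ∣_) lemma p^∣dn))))
    where
    lemma : d ℕ.* (q ℕ.* p) ≡ p ℕ.* (d ℕ.* q)
    lemma = trans (sym (ℕₚ.*-assoc d q p)) (ℕₚ.*-comm (d ℕ.* q) p)

  module _ {p : ℕ} (pr : Prime p) where

    p∤1 : ¬ (p ∣ 1)
    p∤1 p∣1 = ¬prime[1] (subst Prime (∣1⇒≡1 p∣1) pr)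

    p∤* : ∀ {d e} → ¬ (p ∣ d) → ¬ (p ∣ e) → ¬ (p ∣ d ℕ.* e)
    p∤* p∤d p∤e p∣de = [ p∤d , p∤e ]′ (euclidsLemma _ _ pr p∣de)

    ∤⇒≢0 : ∀ {d} → ¬ (p ∣ d) → d ≢ 0
    ∤⇒≢0 p∤d refl = p∤d (p ∣0)

    fromℤ-∈ : ∀ k → fromℤ k ∈ 1 ℤ₍ p ₎
    fromℤ-∈ k = fraction 1 p∤1 k refl

    ι-∈ : ∀ n → ι n ∈ 1 ℤ₍ p ₎
    ι-∈ n = fromℤ-∈ (ℤ.+ n)

    ι-∈-self : ∀ n → ι n ∈ n ℤ₍ p ₎
    ι-∈-self n = fraction 1 p∤1 (ℤ.+ 1) (ℚₚ.*-comm 1ℚ (ι n))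

    0-∈ : ∀ {n} → 0ℚ ∈ n ℤ₍ p ₎
    0-∈ {n} = fraction 1 p∤1 (ℤ.+ 0) (sym (ℚₚ.*-zeroʳ (ι n)))

    ∈-+ : ∀ {n x y} → x ∈ n ℤ₍ p ₎ → y ∈ n ℤ₍ p ₎ → x + y ∈ n ℤ₍ p ₎
    ∈-+ {n} {x} {y} (fraction d p∤d j x≡) (fraction e p∤e k y≡) =
      fraction (d ℕ.* e) (p∤* p∤d p∤e) (ℤ.+ e ℤ.* j ℤ.+ ℤ.+ d ℤ.* k) (begin
        ι (d ℕ.* e) * (x + y)
          ≡⟨ cong (_* (x + y)) (ι-* d e) ⟩
        ι d * ι e * (x + y)
          ≡⟨ solve 4 (λ d e x y → d :* e :* (x :+ y) := e :* (d :* x) :+ d :* (e :* y)) refl (ι d) (ι e) x y ⟩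
        ι e * (ι d * x) + ι d * (ι e * y)
          ≡⟨ cong₂ (λ s t → ι e * s + ι d * t) x≡ y≡ ⟩
        ι e * (ι n * fromℤ j) + ι d * (ι n * fromℤ k)
          ≡⟨ solve 5 (λ d e n j k → e :* (n :* j) :+ d :* (n :* k) := n :* (e :* j :+ d :* k)) refl (ι d) (ι e)
              (ι n) (fromℤ j) (fromℤ k) ⟩
        ι n * (ι e * fromℤ j + ι d * fromℤ k)
          ≡⟨ cong (ι n *_) (trans (fromℤ-+ (ℤ.+ e ℤ.* j) (ℤ.+ d ℤ.* k))
              (cong₂ _+_ (fromℤ-* (ℤ.+ e) j) (fromℤ-* (ℤ.+ d) k))) ⟨
        ι n * fromℤ (ℤ.+ e ℤ.* j ℤ.+ ℤ.+ d ℤ.* k) ∎)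
      where open ≡-Reasoning

    ∈-* : ∀ {m n x y} → x ∈ m ℤ₍ p ₎ → y ∈ n ℤ₍ p ₎ → x * y ∈ m ℕ.* n ℤ₍ p ₎
    ∈-* {m} {n} {x} {y} (fraction d p∤d j x≡) (fraction e p∤e k y≡) =
      fraction (d ℕ.* e) (p∤* p∤d p∤e) (j ℤ.* k) (begin
        ι (d ℕ.* e) * (x * y)
          ≡⟨ cong (_* (x * y)) (ι-* d e) ⟩
        ι d * ι e * (x * y)
          ≡⟨ interchange (ι d) (ι e) x y ⟩
        ι d * x * (ι e * y)
          ≡⟨ cong₂ _*_ x≡ y≡ ⟩
        ι m * fromℤ j * (ι n * fromℤ k)
          ≡⟨ interchange (ι m) (fromℤ j) (ι n) (fromℤ k) ⟩
        ι m * ι n * (fromℤ j * fromℤ k)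
          ≡⟨ cong₂ _*_ (ι-* m n) (fromℤ-* j k) ⟨
        ι (m ℕ.* n) * fromℤ (j ℤ.* k) ∎)
      where
      open ≡-Reasoning
      interchange : ∀ a b c d → a * b * (c * d) ≡ a * c * (b * d)
      interchange = solve 4 (λ a b c d → a :* b :* (c :* d) := a :* c :* (b :* d)) refl

    ∈-*ˡ : ∀ {n x y} → x ∈ 1 ℤ₍ p ₎ → y ∈ n ℤ₍ p ₎ → x * y ∈ n ℤ₍ p ₎
    ∈-*ˡ {n} x∈ y∈ = subst (_ ∈_ℤ₍ p ₎) (ℕₚ.*-identityˡ n) (∈-* x∈ y∈)

    ∈-*ʳ : ∀ {n x y} → x ∈ n ℤ₍ p ₎ → y ∈ 1 ℤ₍ p ₎ → x * y ∈ n ℤ₍ p ₎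
    ∈-*ʳ {n} x∈ y∈ = subst (_ ∈_ℤ₍ p ₎) (ℕₚ.*-identityʳ n) (∈-* x∈ y∈)

    ∈-neg : ∀ {n x} → x ∈ n ℤ₍ p ₎ → - x ∈ n ℤ₍ p ₎
    ∈-neg {n} {x} x∈ = subst (_∈ n ℤ₍ p ₎)
      (trans (sym (ℚₚ.neg-distribˡ-* 1ℚ x)) (cong -_ (ℚₚ.*-identityˡ x))) (∈-*ˡ (fromℤ-∈ (ℤ.-1ℤ)) x∈)

    ∈-- : ∀ {n x y} → x ∈ n ℤ₍ p ₎ → y ∈ n ℤ₍ p ₎ → x - y ∈ n ℤ₍ p ₎
    ∈-- x∈ y∈ = ∈-+ x∈ (∈-neg y∈)

    ∈-weaken : ∀ {m n x} → m ∣ n → x ∈ n ℤ₍ p ₎ → x ∈ m ℤ₍ p ₎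
    ∈-weaken {m} {x = x} (divides q refl) (fraction d p∤d k x≡) = fraction d p∤d (ℤ.+ q ℤ.* k) (begin
      ι d * x                    ≡⟨ x≡ ⟩
      ι (q ℕ.* m) * fromℤ k      ≡⟨ cong (_* fromℤ k) (trans (ι-* q m) (ℚₚ.*-comm (ι q) (ι m))) ⟩
      ι m * ι q * fromℤ k        ≡⟨ ℚₚ.*-assoc (ι m) (ι q) (fromℤ k) ⟩
      ι m * (ι q * fromℤ k)      ≡⟨ cong (ι m *_) (fromℤ-* (ℤ.+ q) k) ⟨
      ι m * fromℤ (ℤ.+ q ℤ.* k)    ∎)
      where open ≡-Reasoning

    -- Integers prime to p are units of the localisation: `u` is absorbed into the denominator.
    ∈-cancel-unit : ∀ {n u x} → ¬ (p ∣ u) → ι u * x ∈ n ℤ₍ p ₎ → x ∈ n ℤ₍ p ₎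
    ∈-cancel-unit {u = u} {x} p∤u (fraction d p∤d k x≡) = fraction (d ℕ.* u) (p∤* p∤d p∤u) k
      (trans (cong (_* x) (ι-* d u)) (trans (ℚₚ.*-assoc (ι d) (ι u) x) x≡))

    ∈-cancel : ∀ m {n x} → m ≢ 0 → ι m * x ∈ m ℕ.* n ℤ₍ p ₎ → x ∈ n ℤ₍ p ₎
    ∈-cancel m {n} {x} m≢0 (fraction d p∤d k x≡) = fraction d p∤d k (*-cancelˡ (ι≢0 m m≢0) (begin
      ι m * (ι d * x)          ≡⟨ solve 3 (λ m d x → m :* (d :* x) := d :* (m :* x)) refl (ι m) (ι d) x ⟩
      ι d * (ι m * x)          ≡⟨ x≡ ⟩
      ι (m ℕ.* n) * fromℤ k    ≡⟨ cong (_* fromℤ k) (ι-* m n) ⟩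
      ι m * ι n * fromℤ k      ≡⟨ ℚₚ.*-assoc (ι m) (ι n) (fromℤ k) ⟩
      ι m * (ι n * fromℤ k)    ∎))
      where open ≡-Reasoning

    -- The way back from the localisation to divisibility of integers: the denominator is prime to
    -- p, so it cancels from p^r ∣ d k.
    fromℤ-∈⇒∣ : ∀ r k → fromℤ k ∈ p ^ r ℤ₍ p ₎ → p ^ r ∣ ∣ k ∣
    fromℤ-∈⇒∣ r k (fraction d p∤d q eq) = ^-∣-cancel pr r p∤d (divides ∣ q ∣ (begin
      d ℕ.* ∣ k ∣             ≡⟨ ℤₚ.abs-* (ℤ.+ d) k ⟨
      ∣ ℤ.+ d ℤ.* k ∣           ≡⟨ cong ∣_∣
          (fromℤ-injective (ℤ.+ d ℤ.* k) (ℤ.+ (p ^ r) ℤ.* q)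
              (trans (fromℤ-* (ℤ.+ d) k) (trans eq (sym (fromℤ-* (ℤ.+ (p ^ r)) q))))) ⟩
      ∣ ℤ.+ (p ^ r) ℤ.* q ∣     ≡⟨ ℤₚ.abs-* (ℤ.+ (p ^ r)) q ⟩
      p ^ r ℕ.* ∣ q ∣         ≡⟨ ℕₚ.*-comm (p ^ r) ∣ q ∣ ⟩
      ∣ q ∣ ℕ.* p ^ r         ∎))
      where open ≡-Reasoning

    ∈⇒∣num : ∀ r {x} → x ∈ p ^ r ℤ₍ p ₎ → p ^ r ∣num x
    ∈⇒∣num r {x} x∈ = fromℤ-∈⇒∣ r (↥ x) (subst (_∈ p ^ r ℤ₍ p ₎) (↧*≡↥ x) (∈-*ˡ (ι-∈ (↧ₙ x)) x∈))

    ∣⇒ι-∈ : ∀ {m n} → m ∣ n → ι n ∈ m ℤ₍ p ₎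
    ∣⇒ι-∈ {m} {n} m∣n = ∈-weaken {m} {n} {ι n} m∣n (ι-∈-self n)

    ∣⇒fromℤ-∈ : ∀ n k → n ∣ ∣ k ∣ → fromℤ k ∈ n ℤ₍ p ₎
    ∣⇒fromℤ-∈ n (ℤ.+ k)        n∣k = ∣⇒ι-∈ n∣k
    ∣⇒fromℤ-∈ n (ℤ.-[1+ k ]) n∣k = ∈-neg {n} {ι (suc k)} (∣⇒ι-∈ n∣k)

    -- Since p ∣ n, the numerator is divisible by p, and lowest terms keep p out of the denominator.
    ∣num⇒∈ : ∀ {n x} → p ∣ n → n ∣num x → x ∈ n ℤ₍ p ₎
    ∣num⇒∈ {n} {x@(mkℚ u v-1 c)} p∣n n∣u =
      ∈-cancel-unit p∤v (subst (_∈ n ℤ₍ p ₎) (sym (↧*≡↥ x)) (∣⇒fromℤ-∈ n u n∣u))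
      where
      p∤v : ¬ (p ∣ suc v-1)
      p∤v p∣v = ¬prime[1] (subst Prime (recompute c (∣-trans p∣n n∣u , p∣v)) pr)

  -- Exponential generating functions

  Σ<-cong : ∀ n {f g} → (∀ k → k < n → f k ≡ g k) → Σ< n f ≡ Σ< n g
  Σ<-cong zero    f≡g = refl
  Σ<-cong (suc n) f≡g = cong₂ _+_ (Σ<-cong n (λ k k<n → f≡g k (ℕₚ.m<n⇒m<1+n k<n))) (f≡g n ℕₚ.≤-refl)

  Σ<-0 : ∀ n → Σ< n (λ _ → 0ℚ) ≡ 0ℚ
  Σ<-0 zero    = refl
  Σ<-0 (suc n) = cong (_+ 0ℚ) (Σ<-0 n)

  Σ<-+ : ∀ n f g → Σ< n (λ k → f k + g k) ≡ Σ< n f + Σ< n g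
  Σ<-+ zero    f g = refl
  Σ<-+ (suc n) f g = trans (cong (_+ (f n + g n)) (Σ<-+ n f g))
    (solve 4 (λ a b c d → (a :+ b) :+ (c :+ d) := (a :+ c) :+ (b :+ d)) refl (Σ< n f) (Σ< n g) (f n) (g n))

  Σ<-head : ∀ n f → Σ< (suc n) f ≡ f 0 + Σ< n (f ∘ suc)
  Σ<-head zero    f = ℚₚ.+-comm 0ℚ (f 0)
  Σ<-head (suc n) f = trans (cong (_+ f (suc n)) (Σ<-head n f)) (ℚₚ.+-assoc (f 0) _ (f (suc n)))

  Σ<-∈ : ∀ {p} (pr : Prime p) {m} n {f} → (∀ k → k < n → f k ∈ m ℤ₍ p ₎) → Σ< n f ∈ m ℤ₍ p ₎
  Σ<-∈ pr zero    f∈ = 0-∈ pr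
  Σ<-∈ pr (suc n) f∈ = ∈-+ pr (Σ<-∈ pr n (λ k k<n → f∈ k (ℕₚ.m<n⇒m<1+n k<n))) (f∈ n ℕₚ.≤-refl)

  -- A sequence F is read as the exponential generating function Σ Fₙ zⁿ / n!.
  -- Then F ∘ suc is its derivative, shift s multiplies it by e^{sz}, ⟨z⟩ multiplies
  -- it by z, dilate a substitutes az for z, and pow i is e^{iz}.

  shift : ℕ → (ℕ → ℚ) → ℕ → ℚ
  shift s F zero    = F 0
  -- The product rule (e^{sz} F)′ = s e^{sz} F + e^{sz} F′; coefficient n + 1 of a series is
  -- coefficient n of its derivative. No binomial sum is involved.
  shift s F (suc n) = ι s * shift s F n + shift s (F ∘ suc) n

  ⟨z⟩ : (ℕ → ℚ) → ℕ → ℚ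
  ⟨z⟩ F zero    = 0ℚ
  ⟨z⟩ F (suc n) = ι (suc n) * F n

  dilate : ℕ → (ℕ → ℚ) → ℕ → ℚ
  dilate a F n = ι (a ^ n) * F n

  pow : ℕ → ℕ → ℚ
  pow i n = ι (i ^ n)

  -- Multiplication by (e^{az} - 1) / (e^z - 1).
  geom : ℕ → (ℕ → ℚ) → ℕ → ℚ
  geom zero    F n = 0ℚ
  geom (suc a) F n = geom a F n + shift a F n

  -- Multiplication by ((e^{az} - 1) / (e^z - 1) - a) / (e^z - 1).
  geom₂ : ℕ → (ℕ → ℚ) → ℕ → ℚ
  geom₂ zero    F n = 0ℚ
  -- ([a](x) - a)/(x - 1) = Σ_{j<a} (x^j - 1)/(x - 1) = Σ_{j<a} [j](x).
  geom₂ (suc a) F n = geom₂ a F n + geom a F n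

  shift-cong : ∀ s n {F G} → (∀ k → k ≤ n → F k ≡ G k) → shift s F n ≡ shift s G n
  shift-cong s zero    F≡G = F≡G 0 z≤n
  shift-cong s (suc n) F≡G = cong₂ (λ x y → ι s * x + y)
    (shift-cong s n (λ k k≤n → F≡G k (ℕₚ.m≤n⇒m≤1+n k≤n)))
    (shift-cong s n (λ k k≤n → F≡G (suc k) (s≤s k≤n)))

  shift-+ : ∀ s F G n → shift s (λ k → F k + G k) n ≡ shift s F n + shift s G n
  shift-+ s F G zero    = refl
  shift-+ s F G (suc n) = trans (cong₂ (λ x y → ι s * x + y) (shift-+ s F G n) (shift-+ s (F ∘ suc) (G ∘ suc) n))
    (solve 5 (λ s a b c d → s :* (a :+ b) :+ (c :+ d) := (s :* a :+ c) :+ (s :* b :+ d)) refl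
      (ι s) (shift s F n) (shift s G n) (shift s (F ∘ suc) n) (shift s (G ∘ suc) n))

  shift-* : ∀ s c F n → shift s (λ k → c * F k) n ≡ c * shift s F n
  shift-* s c F zero    = refl
  shift-* s c F (suc n) = trans (cong₂ (λ x y → ι s * x + y) (shift-* s c F n) (shift-* s c (F ∘ suc) n))
    (solve 4 (λ s c a b → s :* (c :* a) :+ c :* b := c :* (s :* a :+ b)) refl
      (ι s) c (shift s F n) (shift s (F ∘ suc) n))

  shift-- : ∀ s F G n → shift s (λ k → F k - G k) n ≡ shift s F n - shift s G n
  shift-- s F G zero    = refl
  shift-- s F G (suc n) = trans (cong₂ (λ x y → ι s * x + y) (shift-- s F G n) (shift-- s (F ∘ suc) (G ∘ suc) n))
    (solve 5 (λ s a b c d → s :* (a :- b) :+ (c :- d) := (s :* a :+ c) :- (s :* b :+ d)) refl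
      (ι s) (shift s F n) (shift s G n) (shift s (F ∘ suc) n) (shift s (G ∘ suc) n))

  shift-shift : ∀ s t F n → shift s (shift t F) n ≡ shift (s ℕ.+ t) F n
  shift-shift s t F zero    = refl
  shift-shift s t F (suc n) = begin
    ι s * shift s (shift t F) n + shift s (λ k → ι t * shift t F k + shift t (F ∘ suc) k) n
      ≡⟨ cong (λ x → ι s * shift s (shift t F) n + x) (trans (shift-+ s (λ k → ι t * shift t F k) (shift t (F ∘ suc)) n)
           (cong (_+ shift s (shift t (F ∘ suc)) n) (shift-* s (ι t) (shift t F) n))) ⟩
    ι s * shift s (shift t F) n + (ι t * shift s (shift t F) n + shift s (shift t (F ∘ suc)) n)
      ≡⟨ cong₂ (λ x y → ι s * x + (ι t * x + y)) (shift-shift s t F n) (shift-shift s t (F ∘ suc) n) ⟩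
    ι s * A + (ι t * A + B′)
      ≡⟨ solve 4 (λ s t a b → s :* a :+ (t :* a :+ b) := (s :+ t) :* a :+ b) refl (ι s) (ι t) A B′ ⟩
    (ι s + ι t) * A + B′
      ≡⟨ cong (λ x → x * A + B′) (ι-+ s t) ⟨
    ι (s ℕ.+ t) * A + B′ ∎
    where
    open ≡-Reasoning
    A = shift (s ℕ.+ t) F n
    B′ = shift (s ℕ.+ t) (F ∘ suc) n

  shift-comm : ∀ s t F n → shift s (shift t F) n ≡ shift t (shift s F) n
  shift-comm s t F n = trans (shift-shift s t F n)
    (trans (cong (λ u → shift u F n) (ℕₚ.+-comm s t)) (sym (shift-shift t s F n)))

  shift-0 : ∀ F n → shift 0 F n ≡ F n
  shift-0 F zero    = refl
  shift-0 F (suc n) = trans (cong₂ _+_ (ℚₚ.*-zeroˡ (shift 0 F n)) (shift-0 (F ∘ suc) n)) (ℚₚ.+-identityˡ (F (suc n)))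

  shift-pow : ∀ s i n → shift s (pow i) n ≡ pow (s ℕ.+ i) n
  shift-pow s i zero    = refl
  shift-pow s i (suc n) = begin
    ι s * shift s (pow i) n + shift s (λ k → ι (i ℕ.* i ^ k)) n
      ≡⟨ cong (λ x → ι s * shift s (pow i) n + x)
          (trans (shift-cong s n (λ k _ → ι-* i (i ^ k))) (shift-* s (ι i) (pow i) n)) ⟩
    ι s * shift s (pow i) n + ι i * shift s (pow i) n
      ≡⟨ ℚₚ.*-distribʳ-+ (shift s (pow i) n) (ι s) (ι i) ⟨
    (ι s + ι i) * shift s (pow i) n
      ≡⟨ cong₂ _*_ (sym (ι-+ s i)) (shift-pow s i n) ⟩
    ι (s ℕ.+ i) * pow (s ℕ.+ i) n
      ≡⟨ ι-* (s ℕ.+ i) ((s ℕ.+ i) ^ n) ⟨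
    pow (s ℕ.+ i) (suc n) ∎
    where open ≡-Reasoning

  shift-dilate : ∀ a F n → shift a (dilate a F) n ≡ dilate a (shift 1 F) n
  shift-dilate a F zero    = refl
  shift-dilate a F (suc n) = begin
    ι a * shift a (dilate a F) n + shift a (dilate a F ∘ suc) n
      ≡⟨ cong (λ x → ι a * shift a (dilate a F) n + x)
          (trans (shift-cong a n
              (λ k _ → trans (cong (_* F (suc k)) (ι-* a (a ^ k))) (ℚₚ.*-assoc (ι a) (ι (a ^ k)) (F (suc k)))))
          (shift-* a (ι a) (dilate a (F ∘ suc)) n)) ⟩
    ι a * shift a (dilate a F) n + ι a * shift a (dilate a (F ∘ suc)) n
      ≡⟨ cong₂ (λ x y → ι a * x + ι a * y) (shift-dilate a F n) (shift-dilate a (F ∘ suc) n) ⟩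
    ι a * (ι (a ^ n) * shift 1 F n) + ι a * (ι (a ^ n) * shift 1 (F ∘ suc) n)
      ≡⟨ solve 4 (λ a b x y → a :* (b :* x) :+ a :* (b :* y) := a :* b :* (con 1ℚ :* x :+ y)) refl
           (ι a) (ι (a ^ n)) (shift 1 F n) (shift 1 (F ∘ suc) n) ⟩
    ι a * ι (a ^ n) * (1ℚ * shift 1 F n + shift 1 (F ∘ suc) n)
      ≡⟨ cong (_* (1ℚ * shift 1 F n + shift 1 (F ∘ suc) n)) (ι-* a (a ^ n)) ⟨
    dilate a (shift 1 F) (suc n) ∎
    where open ≡-Reasoning

  ⟨z⟩-+ : ∀ F G n → ⟨z⟩ (λ k → F k + G k) n ≡ ⟨z⟩ F n + ⟨z⟩ G n
  ⟨z⟩-+ F G zero    = refl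
  ⟨z⟩-+ F G (suc n) = ℚₚ.*-distribˡ-+ (ι (suc n)) (F n) (G n)

  ⟨z⟩-* : ∀ c F n → ⟨z⟩ (λ k → c * F k) n ≡ c * ⟨z⟩ F n
  ⟨z⟩-* c F zero    = sym (ℚₚ.*-zeroʳ c)
  ⟨z⟩-* c F (suc n) = solve 3 (λ s c f → s :* (c :* f) := c :* (s :* f)) refl (ι (suc n)) c (F n)

  ⟨z⟩-injective : ∀ {F G} → (∀ n → ⟨z⟩ F n ≡ ⟨z⟩ G n) → ∀ n → F n ≡ G n
  ⟨z⟩-injective eq n = *-cancelˡ (ι-suc≢0 n) (eq (suc n))

  ⟨z⟩-product-rule : ∀ F n → ⟨z⟩ F (suc n) ≡ F n + ⟨z⟩ (F ∘ suc) n
  ⟨z⟩-product-rule F zero    = trans (ℚₚ.*-identityˡ (F 0)) (sym (ℚₚ.+-identityʳ (F 0)))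
  ⟨z⟩-product-rule F (suc n) = trans (cong (_* F (suc n)) (ι-suc (suc n)))
    (solve 2 (λ s f → (con 1ℚ :+ s) :* f := f :+ s :* f) refl (ι (suc n)) (F (suc n)))

  shift-⟨z⟩ : ∀ s F n → shift s (⟨z⟩ F) n ≡ ⟨z⟩ (shift s F) n
  shift-⟨z⟩ s F zero    = refl
  shift-⟨z⟩ s F (suc n) = begin
    ι s * shift s (⟨z⟩ F) n + shift s (⟨z⟩ F ∘ suc) n
      ≡⟨ cong (λ x → ι s * shift s (⟨z⟩ F) n + x)
          (trans (shift-cong s n (λ k _ → ⟨z⟩-product-rule F k)) (shift-+ s F (⟨z⟩ (F ∘ suc)) n)) ⟩
    ι s * shift s (⟨z⟩ F) n + (shift s F n + shift s (⟨z⟩ (F ∘ suc)) n)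
      ≡⟨ cong₂ (λ x y → ι s * x + (shift s F n + y)) (shift-⟨z⟩ s F n) (shift-⟨z⟩ s (F ∘ suc) n) ⟩
    ι s * ⟨z⟩ (shift s F) n + (shift s F n + ⟨z⟩ (shift s (F ∘ suc)) n)
      ≡⟨ solve 4 (λ s x f y → s :* x :+ (f :+ y) := f :+ (s :* x :+ y)) refl (ι s) (⟨z⟩ (shift s F) n)
          (shift s F n) (⟨z⟩ (shift s (F ∘ suc)) n) ⟩
    shift s F n + (ι s * ⟨z⟩ (shift s F) n + ⟨z⟩ (shift s (F ∘ suc)) n)
      ≡⟨ cong (shift s F n +_) (trans (⟨z⟩-+ (λ k → ι s * shift s F k) (shift s (F ∘ suc)) n)
           (cong (_+ ⟨z⟩ (shift s (F ∘ suc)) n) (⟨z⟩-* (ι s) (shift s F) n))) ⟨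
    shift s F n + ⟨z⟩ (shift s F ∘ suc) n
      ≡⟨ ⟨z⟩-product-rule (shift s F) n ⟨
    ⟨z⟩ (shift s F) (suc n) ∎
    where open ≡-Reasoning

  geom-cong : ∀ a n {F G} → (∀ k → k ≤ n → F k ≡ G k) → geom a F n ≡ geom a G n
  geom-cong zero    n F≡G = refl
  geom-cong (suc a) n F≡G = cong₂ _+_ (geom-cong a n F≡G) (shift-cong a n F≡G)

  geom-+ : ∀ a F G n → geom a (λ k → F k + G k) n ≡ geom a F n + geom a G n
  geom-+ zero    F G n = refl
  geom-+ (suc a) F G n = trans (cong₂ _+_ (geom-+ a F G n) (shift-+ a F G n))
    (solve 4 (λ a b c d → (a :+ b) :+ (c :+ d) := (a :+ c) :+ (b :+ d)) refl (geom a F n) (geom a G n)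
        (shift a F n) (shift a G n))

  geom-⟨z⟩ : ∀ a F n → geom a (⟨z⟩ F) n ≡ ⟨z⟩ (geom a F) n
  geom-⟨z⟩ zero    F zero    = refl
  geom-⟨z⟩ zero    F (suc n) = sym (ℚₚ.*-zeroʳ (ι (suc n)))
  geom-⟨z⟩ (suc a) F n = trans (cong₂ _+_ (geom-⟨z⟩ a F n) (shift-⟨z⟩ a F n)) (sym (⟨z⟩-+ (geom a F) (shift a F) n))

  shift-zeros : ∀ s n → shift s (λ _ → 0ℚ) n ≡ 0ℚ
  shift-zeros s zero    = refl
  shift-zeros s (suc n) = trans (cong₂ (λ x y → ι s * x + y) (shift-zeros s n) (shift-zeros s n))
    (trans (ℚₚ.+-identityʳ (ι s * 0ℚ)) (ℚₚ.*-zeroʳ (ι s)))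

  shift-geom : ∀ s a F n → shift s (geom a F) n ≡ geom a (shift s F) n
  shift-geom s zero    F n = shift-zeros s n
  shift-geom s (suc a) F n = trans (shift-+ s (geom a F) (shift a F) n)
    (cong₂ _+_ (shift-geom s a F n) (shift-comm s a F n))

  -- The identity (x - 1)[a](x) = x^a - 1 at x = e^z, with the subtracted terms moved across.
  shift-1-geom : ∀ a F n → shift 1 (geom a F) n + F n ≡ geom a F n + shift a F n
  shift-1-geom zero    F n = cong₂ _+_ (shift-zeros 1 n) (sym (shift-0 F n))
  shift-1-geom (suc a) F n = begin
    shift 1 (geom (suc a) F) n + F n
      ≡⟨ cong (_+ F n) (trans (shift-+ 1 (geom a F) (shift a F) n)
          (cong (shift 1 (geom a F) n +_) (shift-shift 1 a F n))) ⟩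
    shift 1 (geom a F) n + shift (suc a) F n + F n
      ≡⟨ solve 3 (λ x y f → x :+ y :+ f := (x :+ f) :+ y) refl (shift 1 (geom a F) n) (shift (suc a) F n) (F n) ⟩
    shift 1 (geom a F) n + F n + shift (suc a) F n
      ≡⟨ cong (_+ shift (suc a) F n) (shift-1-geom a F n) ⟩
    geom (suc a) F n + shift (suc a) F n ∎
    where open ≡-Reasoning

  geom₂-cong : ∀ a n {F G} → (∀ k → k ≤ n → F k ≡ G k) → geom₂ a F n ≡ geom₂ a G n
  geom₂-cong zero    n F≡G = refl
  geom₂-cong (suc a) n F≡G = cong₂ _+_ (geom₂-cong a n F≡G) (geom-cong a n F≡G)

  -- The identity (x - 1)G(x) = [a](x) - a at x = e^z, again without subtraction.
  shift-1-geom₂ : ∀ a F n → shift 1 (geom₂ a F) n + ι a * F n ≡ geom₂ a F n + geom a F n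
  shift-1-geom₂ zero    F n = trans (cong₂ _+_ (shift-zeros 1 n) (ℚₚ.*-zeroˡ (F n))) refl
  shift-1-geom₂ (suc a) F n = begin
    shift 1 (geom₂ (suc a) F) n + ι (suc a) * F n
      ≡⟨ cong₂ _+_ (shift-+ 1 (geom₂ a F) (geom a F) n) (cong (_* F n) (ι-suc a)) ⟩
    shift 1 (geom₂ a F) n + shift 1 (geom a F) n + (1ℚ + ι a) * F n
      ≡⟨ solve 4 (λ x y a f → x :+ y :+ (con 1ℚ :+ a) :* f := (x :+ a :* f) :+ (y :+ f)) refl
          (shift 1 (geom₂ a F) n) (shift 1 (geom a F) n) (ι a) (F n) ⟩
    (shift 1 (geom₂ a F) n + ι a * F n) + (shift 1 (geom a F) n + F n)
      ≡⟨ cong₂ _+_ (shift-1-geom₂ a F n) (shift-1-geom a F n) ⟩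
    geom₂ (suc a) F n + geom (suc a) F n ∎
    where open ≡-Reasoning

  nCn-1 : ∀ n → suc n C n ≡ suc n
  nCn-1 n = trans (nCk≡nC[n∸k] (ℕₚ.n≤1+n n)) (trans (cong (suc n C_) (ℕₚ.m+n∸n≡m 1 n)) (nC1≡n (suc n)))

  -- Pascal's rule turns the product-rule recursion into the usual binomial convolution, the form in
  -- which the Bernoulli recurrence and the divisibility of binomial coefficients can be applied.
  shift-1-binomial : ∀ F n → shift 1 F n ≡ Σ< (suc n) (λ k → ι (n C k) * F k)
  shift-1-binomial F zero    = sym (trans (ℚₚ.+-identityˡ (1ℚ * F 0)) (ℚₚ.*-identityˡ (F 0)))
  shift-1-binomial F (suc n) = begin
    1ℚ * shift 1 F n + shift 1 (F ∘ suc) n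
      ≡⟨ cong₂ (λ x y → 1ℚ * x + y) (shift-1-binomial F n) (shift-1-binomial (F ∘ suc) n) ⟩
    1ℚ * Σ< (suc n) f + Σ< (suc n) g
      ≡⟨ cong (λ x → 1ℚ * x + Σ< (suc n) g) (trans (sym top≡0) (Σ<-head (suc n) f)) ⟩
    1ℚ * (f 0 + Σ< (suc n) (f ∘ suc)) + Σ< (suc n) g
      ≡⟨ solve 3 (λ a b c → con 1ℚ :* (a :+ b) :+ c := a :+ (c :+ b)) refl (f 0) (Σ< (suc n) (f ∘ suc)) (Σ< (suc n) g) ⟩
    f 0 + (Σ< (suc n) g + Σ< (suc n) (f ∘ suc))
      ≡⟨ cong (f 0 +_) (Σ<-+ (suc n) g (f ∘ suc)) ⟨
    f 0 + Σ< (suc n) (λ k → g k + f (suc k))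
      ≡⟨ cong (f 0 +_) (Σ<-cong (suc n) (λ k _ → pascal k)) ⟩
    f 0 + Σ< (suc n) (λ k → ι (suc n C suc k) * F (suc k))
      ≡⟨ Σ<-head (suc n) (λ k → ι (suc n C k) * F k) ⟨
    Σ< (suc (suc n)) (λ k → ι (suc n C k) * F k) ∎
    where
    open ≡-Reasoning
    f g : ℕ → ℚ
    f k = ι (n C k) * F k
    g k = ι (n C k) * F (suc k)
    top≡0 : Σ< (suc (suc n)) f ≡ Σ< (suc n) f
    top≡0 = trans (cong (λ c → Σ< (suc n) f + ι c * F (suc n)) (k>n⇒nCk≡0 (ℕₚ.n<1+n n)))
      (trans (cong (Σ< (suc n) f +_) (ℚₚ.*-zeroˡ (F (suc n)))) (ℚₚ.+-identityʳ (Σ< (suc n) f)))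
    pascal : ∀ k → g k + f (suc k) ≡ ι (suc n C suc k) * F (suc k)
    pascal k = trans (sym (ℚₚ.*-distribʳ-+ (F (suc k)) (ι (n C k)) (ι (n C suc k))))
      (cong (_* F (suc k)) (trans (sym (ι-+ (n C k) (n C suc k))) (cong ι (nCk+nC[k+1]≡[n+1]C[k+1] n k))))

  shift-1-lower : ∀ F n → shift 1 F n ≡ Σ< n (λ k → ι (n C k) * F k) + F n
  shift-1-lower F n = trans (shift-1-binomial F n)
    (cong (Σ< n (λ k → ι (n C k) * F k) +_) (trans (cong (λ c → ι c * F n) (nCn≡1 n)) (ℚₚ.*-identityˡ (F n))))

  shift-1-lower₂ : ∀ F n → shift 1 F (suc n) ≡ Σ< n (λ k → ι (suc n C k) * F k) + ι (suc n) * F n + F (suc n)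
  shift-1-lower₂ F n = trans (shift-1-lower F (suc n))
    (cong (λ c → Σ< n (λ k → ι (suc n C k) * F k) + ι c * F n + F (suc n)) (nCn-1 n))

  -- Bernoulli numbers

  -- e^z - 1 is z times a unit, so it is no zero divisor: coefficient n + 1 of (e^z - 1)F is (n +
  -- 1)Fₙ plus a combination of earlier Fₖ, and strong induction gives Fₙ = 0.
  Δ-injective : ∀ {F} → (∀ n → shift 1 F n ≡ F n) → ∀ n → F n ≡ 0ℚ
  Δ-injective {F} fixed n = below (suc n) n ℕₚ.≤-refl
    where
    open ≡-Reasoning
    step : ∀ n → (∀ k → k < n → F k ≡ 0ℚ) → F n ≡ 0ℚ
    step n zeros = *-cancelˡ (ι-suc≢0 n) (begin
      ι (suc n) * F n
        ≡⟨ solve 3 (λ s x y → x := (s :+ x :+ y) :- y :- s) refl s (ι (suc n) * F n) (F (suc n)) ⟩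
      s + ι (suc n) * F n + F (suc n) - F (suc n) - s
        ≡⟨ cong (λ t → t - F (suc n) - s) (trans (sym (shift-1-lower₂ F n)) (fixed (suc n))) ⟩
      F (suc n) - F (suc n) - s
        ≡⟨ cong (λ t → F (suc n) - F (suc n) - t) s≡0 ⟩
      F (suc n) - F (suc n) - 0ℚ
        ≡⟨ solve 2 (λ x a → x :- x :- con 0ℚ := a :* con 0ℚ) refl (F (suc n)) (ι (suc n)) ⟩
      ι (suc n) * 0ℚ ∎)
      where
      s = Σ< n (λ k → ι (suc n C k) * F k)
      s≡0 : s ≡ 0ℚ
      s≡0 = trans (Σ<-cong n
          (λ k k<n → trans (cong (ι (suc n C k) *_) (zeros k k<n)) (ℚₚ.*-zeroʳ (ι (suc n C k))))) (Σ<-0 n)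
    below : ∀ m n → n < m → F n ≡ 0ℚ
    below (suc m) n n<m = step n (λ k k<n → below m k (ℕₚ.<-≤-trans k<n (ℕₚ.≤-pred n<m)))

  -- `pow 0` is the constant series 1, because 0⁰ = 1, so `⟨z⟩ (pow 0)` is the series z and this is
  -- (e^z - 1)B(z) = z.
  shift-1-B : ∀ n → shift 1 B n ≡ B n + ⟨z⟩ (pow 0) n
  shift-1-B zero          = refl
  shift-1-B (suc zero)    = refl
  shift-1-B (suc (suc n)) = begin
    shift 1 B (2 ℕ.+ n)
      ≡⟨ shift-1-lower B (2 ℕ.+ n) ⟩
    Σ< (2 ℕ.+ n) (λ k → ι ((2 ℕ.+ n) C k) * B k) + B (2 ℕ.+ n)
      ≡⟨ cong (_+ B (2 ℕ.+ n)) (bernoulli-recurrence n) ⟩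
    0ℚ + B (2 ℕ.+ n)
      ≡⟨ ℚₚ.+-comm 0ℚ (B (2 ℕ.+ n)) ⟩
    B (2 ℕ.+ n) + 0ℚ
      ≡⟨ cong (λ x → B (2 ℕ.+ n) + x) (ℚₚ.*-zeroʳ (ι (2 ℕ.+ n))) ⟨
    B (2 ℕ.+ n) + ⟨z⟩ (pow 0) (2 ℕ.+ n) ∎
    where open ≡-Reasoning

  suc-^-pred : ∀ b n → suc b ^ n ≡ suc (suc b ^ n ∸ 1)
  suc-^-pred b n = sym (ℕₚ.m+[n∸m]≡n (ℕₚ.m^n>0 (suc b) n))

  abstract

    regularised : ℕ → ℕ → ℚ
    regularised a n = (1ℚ - ι (a ^ suc n)) * B/ (suc n)

    -- With B(z) = z/(e^z - 1) the right side is B(z) - B(az). Its constant term vanishes, which is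
    -- the cancellation of the two poles 1/z, so dividing by z stays within power series.
    ⟨z⟩-regularised : ∀ a n → ⟨z⟩ (regularised a) n ≡ B n - dilate a B n
    ⟨z⟩-regularised a zero    = refl
    ⟨z⟩-regularised a (suc n) = begin
      ι (suc n) * ((1ℚ - A) * B/ (suc n))
        ≡⟨ solve 3 (λ s a b → s :* ((con 1ℚ :- a) :* b) := b :* s :- a :* (b :* s)) refl (ι (suc n)) A (B/ (suc n)) ⟩
      B/ (suc n) * ι (suc n) - A * (B/ (suc n) * ι (suc n))
        ≡⟨ cong (λ t → t - A * t) (÷₀-* (B (suc n)) (ι-suc≢0 n)) ⟩
      B (suc n) - A * B (suc n) ∎
      where
      open ≡-Reasoning
      A : ℚ
      A = ι (a ^ suc n)

    -- A base of the form b + 1 has powers at least 1, so the truncated difference is the true one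
    -- and divisibility of the factor can be discussed in ℕ.
    regularised-suc : ∀ b n → regularised (suc b) n ≡ - (ι (suc b ^ suc n ∸ 1) * B/ (suc n))
    regularised-suc b n = trans
      (cong (λ x → (1ℚ - x) * B/ (suc n)) (trans (cong ι (suc-^-pred b (suc n))) (ι-suc (suc b ^ suc n ∸ 1))))
      (solve 2 (λ c x → (con 1ℚ :- (con 1ℚ :+ c)) :* x := :- (c :* x)) refl (ι (suc b ^ suc n ∸ 1)) (B/ (suc n)))

  dilate-⟨z⟩-pow-0 : ∀ a n → dilate a (⟨z⟩ (pow 0)) n ≡ ι a * ⟨z⟩ (pow 0) n
  dilate-⟨z⟩-pow-0 a zero          = trans (ℚₚ.*-zeroʳ (ι 1)) (sym (ℚₚ.*-zeroʳ (ι a)))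
  dilate-⟨z⟩-pow-0 a (suc zero)    = cong (λ k → ι k * (1ℚ * 1ℚ)) (ℕₚ.*-identityʳ a)
  dilate-⟨z⟩-pow-0 a (suc (suc n)) = begin
    ι (a ^ (2 ℕ.+ n)) * (ι (2 ℕ.+ n) * 0ℚ)
      ≡⟨ solve 3 (λ x y z → x :* (y :* con 0ℚ) := z :* (y :* con 0ℚ)) refl (ι (a ^ (2 ℕ.+ n))) (ι (2 ℕ.+ n)) (ι a) ⟩
    ι a * (ι (2 ℕ.+ n) * 0ℚ) ∎
    where open ≡-Reasoning

  -- (e^{az} - 1)B = [a](e^z)(e^z - 1)B = z [a](e^z).
  shift-B : ∀ a n → shift a B n ≡ ⟨z⟩ (geom a (pow 0)) n + B n
  shift-B a n = begin
    shift a B n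
      ≡⟨ solve 2 (λ x y → x := (y :+ x) :- y) refl (shift a B n) (geom a B n) ⟩
    geom a B n + shift a B n - geom a B n
      ≡⟨ cong (_- geom a B n) (shift-1-geom a B n) ⟨
    shift 1 (geom a B) n + B n - geom a B n
      ≡⟨ cong (λ t → t + B n - geom a B n) (begin
          shift 1 (geom a B) n                        ≡⟨ shift-geom 1 a B n ⟩
          geom a (shift 1 B) n                        ≡⟨ geom-cong a n (λ k _ → shift-1-B k) ⟩
          geom a (λ k → B k + ⟨z⟩ (pow 0) k) n        ≡⟨ geom-+ a B (⟨z⟩ (pow 0)) n ⟩
          geom a B n + geom a (⟨z⟩ (pow 0)) n         ≡⟨ cong (λ x → geom a B n + x) (geom-⟨z⟩ a (pow 0) n) ⟩
          geom a B n + ⟨z⟩ (geom a (pow 0)) n         ∎) ⟩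
    geom a B n + ⟨z⟩ (geom a (pow 0)) n + B n - geom a B n
      ≡⟨ solve 3 (λ x y z → x :+ y :+ z :- x := y :+ z) refl (geom a B n) (⟨z⟩ (geom a (pow 0)) n) (B n) ⟩
    ⟨z⟩ (geom a (pow 0)) n + B n ∎
    where open ≡-Reasoning

  -- This is (e^{az} - 1)E = [a](e^z) - a for the regularised series E. It is checked after
  -- multiplication by z, where (e^{az} - 1)B(az) = az accounts for the term with a.
  shift-regularised : ∀ a n →
    shift a (regularised a) n + ι a * pow 0 n ≡ regularised a n + geom a (pow 0) n
  shift-regularised a = ⟨z⟩-injective λ n → begin
    ⟨z⟩ (λ k → shift a E k + ι a * pow 0 k) n
      ≡⟨ ⟨z⟩-+ (shift a E) (λ k → ι a * pow 0 k) n ⟩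
    ⟨z⟩ (shift a E) n + ⟨z⟩ (λ k → ι a * pow 0 k) n
      ≡⟨ cong₂ _+_ (sym (shift-⟨z⟩ a E n)) (⟨z⟩-* (ι a) (pow 0) n) ⟩
    shift a (⟨z⟩ E) n + ι a * δ n
      ≡⟨ cong (_+ ι a * δ n) (trans (shift-cong a n (λ k _ → ⟨z⟩-regularised a k)) (shift-- a B (dilate a B) n)) ⟩
    shift a B n - shift a (dilate a B) n + ι a * δ n
      ≡⟨ cong₂ (λ x y → x - y + ι a * δ n) (shift-B a n) (shift-dilate a B n) ⟩
    ⟨z⟩ (geom a (pow 0)) n + B n - ι (a ^ n) * shift 1 B n + ι a * δ n
      ≡⟨ cong₂ (λ x y → ⟨z⟩ (geom a (pow 0)) n + B n - ι (a ^ n) * x + y) (shift-1-B n) (sym (dilate-⟨z⟩-pow-0 a n)) ⟩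
    ⟨z⟩ (geom a (pow 0)) n + B n - ι (a ^ n) * (B n + δ n) + ι (a ^ n) * δ n
      ≡⟨ solve 4 (λ g b p d → g :+ b :- p :* (b :+ d) :+ p :* d := (b :- p :* b) :+ g) refl
           (⟨z⟩ (geom a (pow 0)) n) (B n) (ι (a ^ n)) (δ n) ⟩
    B n - dilate a B n + ⟨z⟩ (geom a (pow 0)) n
      ≡⟨ cong (_+ ⟨z⟩ (geom a (pow 0)) n) (⟨z⟩-regularised a n) ⟨
    ⟨z⟩ E n + ⟨z⟩ (geom a (pow 0)) n
      ≡⟨ ⟨z⟩-+ E (geom a (pow 0)) n ⟨
    ⟨z⟩ (λ k → E k + geom a (pow 0) k) n ∎
    where
    open ≡-Reasoning
    E δ : ℕ → ℚ
    E = regularised a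
    δ = ⟨z⟩ (pow 0)

  -- [a](e^z)E = G(e^z): both sides agree after multiplication by e^z - 1, so their difference is
  -- fixed by e^z and hence zero.
  geom-regularised : ∀ a n → geom a (regularised a) n ≡ geom₂ a (pow 0) n
  geom-regularised a n = begin
    G n               ≡⟨ solve 2 (λ x y → x := y :+ (x :- y)) refl (G n) (H n) ⟩
    H n + (G n - H n) ≡⟨ cong (λ x → H n + x) (Δ-injective fixed n) ⟩
    H n + 0ℚ          ≡⟨ ℚₚ.+-identityʳ (H n) ⟩
    H n               ∎
    where
    open ≡-Reasoning
    E G H : ℕ → ℚ
    E = regularised a
    G = geom a E
    H = geom₂ a (pow 0)
    fixed : ∀ n → shift 1 (λ k → G k - H k) n ≡ G n - H n
    fixed n = begin
      shift 1 (λ k → G k - H k) n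
        ≡⟨ shift-- 1 G H n ⟩
      shift 1 G n - shift 1 H n
        ≡⟨ solve 4 (λ g h e p → g :- h := (g :+ e) :- (h :+ p) :+ p :- e) refl (shift 1 G n) (shift 1 H n) (E n) P ⟩
      (shift 1 G n + E n) - (shift 1 H n + P) + P - E n
        ≡⟨ cong₂ (λ x y → x - y + P - E n) (shift-1-geom a E n) (shift-1-geom₂ a (pow 0) n) ⟩
      (G n + shift a E n) - (H n + geom a (pow 0) n) + P - E n
        ≡⟨ solve 6 (λ g s h k p e → (g :+ s) :- (h :+ k) :+ p :- e := (g :- h) :+ (s :+ p) :- (e :+ k)) refl
             (G n) (shift a E n) (H n) (geom a (pow 0) n) P (E n) ⟩
      (G n - H n) + (shift a E n + P) - (E n + geom a (pow 0) n)
        ≡⟨ cong (λ x → (G n - H n) + x - (E n + geom a (pow 0) n)) (shift-regularised a n) ⟩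
      (G n - H n) + (E n + geom a (pow 0) n) - (E n + geom a (pow 0) n)
        ≡⟨ solve 2 (λ x y → x :+ y :- y := x) refl (G n - H n) (E n + geom a (pow 0) n) ⟩
      G n - H n ∎
      where P = ι a * pow 0 n

  -- Substituting [a](x) = a + (x - 1)G(x) into [a](x)E = G(x) gives aE = G(x) - (x - 1)G(x)E.
  -- Because of the factor x - 1 = e^z - 1, coefficient n of the right side involves E only at
  -- indices below n.
  regularised-recurrence : ∀ a n →
    ι a * regularised a n ≡ geom₂ a (pow 0) n + (geom₂ a (regularised a) n - shift 1 (geom₂ a (regularised a)) n)
  regularised-recurrence a n = begin
    x                                   ≡⟨ solve 2 (λ x s → x := (s :+ x) :- s) refl x s ⟩
    s + x - s                           ≡⟨ cong (_- s) (shift-1-geom₂ a (regularised a) n) ⟩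
    g + geom a (regularised a) n - s    ≡⟨ cong (λ t → g + t - s) (geom-regularised a n) ⟩
    g + geom₂ a (pow 0) n - s           ≡⟨ solve 3 (λ g h s → g :+ h :- s := h :+ (g :- s)) refl g
        (geom₂ a (pow 0) n) s ⟩
    geom₂ a (pow 0) n + (g - s)         ∎
    where
    open ≡-Reasoning
    x = ι a * regularised a n
    g = geom₂ a (regularised a) n
    s = shift 1 (geom₂ a (regularised a)) n

  -- The span over ℤ₍ₚ₎ of the functions n ↦ iⁿ, that is, of the series e^{iz}. Being inductive, it
  -- reduces a congruence that respects sums and scalars to single powers; `equal` makes it
  -- invariant under pointwise equality.
  data PowerSum (p : ℕ) : (ℕ → ℚ) → Set where
    power : ∀ i → PowerSum p (pow i)
    sum   : ∀ {F G} → PowerSum p F → PowerSum p G → PowerSum p (λ n → F n + G n)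
    scale : ∀ {c F} → c ∈ 1 ℤ₍ p ₎ → PowerSum p F → PowerSum p (λ n → c * F n)
    equal : ∀ {F G} → (∀ n → F n ≡ G n) → PowerSum p F → PowerSum p G

  module _ {p : ℕ} (pr : Prime p) where

    PowerSum-zeros : PowerSum p (λ _ → 0ℚ)
    PowerSum-zeros = equal (λ n → ℚₚ.*-zeroˡ (pow 0 n)) (scale (0-∈ pr) (power 0))

    PowerSum-neg : ∀ {F} → PowerSum p F → PowerSum p (λ n → - F n)
    PowerSum-neg {F} F∈ = equal (λ n → solve 1 (λ x → :- con 1ℚ :* x := :- x) refl (F n))
      (scale (∈-neg pr (ι-∈ pr 1)) F∈)

    PowerSum-shift : ∀ s {F} → PowerSum p F → PowerSum p (shift s F)
    PowerSum-shift s (power i)           = equal (λ n → sym (shift-pow s i n)) (power (s ℕ.+ i))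
    PowerSum-shift s (sum {F} {G} F∈ G∈) = equal (λ n → sym (shift-+ s F G n))
        (sum (PowerSum-shift s F∈) (PowerSum-shift s G∈))
    PowerSum-shift s (scale {c} {F} c∈ F∈) = equal (λ n → sym (shift-* s c F n)) (scale c∈ (PowerSum-shift s F∈))
    PowerSum-shift s (equal F≡G F∈)      = equal (λ n → shift-cong s n (λ k _ → F≡G k)) (PowerSum-shift s F∈)

    PowerSum-geom : ∀ a {F} → PowerSum p F → PowerSum p (geom a F)
    PowerSum-geom zero    F∈ = PowerSum-zeros
    PowerSum-geom (suc a) F∈ = sum (PowerSum-geom a F∈) (PowerSum-shift a F∈)

    PowerSum-geom₂ : ∀ a {F} → PowerSum p F → PowerSum p (geom₂ a F)
    PowerSum-geom₂ zero    F∈ = PowerSum-zeros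
    PowerSum-geom₂ (suc a) F∈ = sum (PowerSum-geom₂ a F∈) (PowerSum-geom a F∈)

    private
      extend : ∀ {a} → ¬ (p ∣ a) → ∀ N {F} → PowerSum p F → (∀ n → n < N → regularised a n ≡ F n) →
        ∃[ G ] PowerSum p G × (∀ n → n < suc N → regularised a n ≡ G n)
      extend {a} p∤a N {F} F∈ E≡F = F′ , F′∈ , E≡F′
        where
        open ≡-Reasoning
        E F′ : ℕ → ℚ
        E = regularised a
        ιa≢0 : ι a ≢ 0ℚ
        ιa≢0 = ι≢0 a (∤⇒≢0 pr p∤a)
        inverse∈ : (1ℚ ÷₀ ι a) ∈ 1 ℤ₍ p ₎
        inverse∈ = ∈-cancel-unit pr p∤a (subst (_∈ 1 ℤ₍ p ₎)
          (sym (trans (ℚₚ.*-comm (ι a) (1ℚ ÷₀ ι a)) (÷₀-* 1ℚ ιa≢0))) (ι-∈ pr 1))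
        -- The right side of `regularised-recurrence` divided by a, with the known approximation F
        -- in place of the sequence itself.
        F′ n = (1ℚ ÷₀ ι a) * (geom₂ a (pow 0) n + (geom₂ a F n - shift 1 (geom₂ a F) n))
        F′∈ : PowerSum p F′
        F′∈ = scale inverse∈ (sum (PowerSum-geom₂ a (power 0))
          (sum (PowerSum-geom₂ a F∈) (PowerSum-neg (PowerSum-shift 1 (PowerSum-geom₂ a F∈)))))
        -- In coefficient n of (e^z - 1)G the two top terms Gₙ cancel, so only earlier coefficients
        -- matter.
        Δ-local : ∀ {G H : ℕ → ℚ} n → (∀ k → k < n → G k ≡ H k) → G n - shift 1 G n ≡ H n - shift 1 H n
        Δ-local {G} {H} n G≡H = begin
          G n - shift 1 G n            ≡⟨ lower G ⟩
          - Σ< n (λ k → ι (n C k) * G k) ≡⟨ cong -_ (Σ<-cong n (λ k k<n → cong (ι (n C k) *_) (G≡H k k<n))) ⟩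
          - Σ< n (λ k → ι (n C k) * H k) ≡⟨ lower H ⟨
          H n - shift 1 H n            ∎
          where
          lower : ∀ K → K n - shift 1 K n ≡ - Σ< n (λ k → ι (n C k) * K k)
          lower K = trans (cong (λ x → K n - x) (shift-1-lower K n))
            (solve 2 (λ x s → x :- (s :+ x) := :- s) refl (K n) (Σ< n (λ k → ι (n C k) * K k)))
        E≡F′ : ∀ n → n < suc N → E n ≡ F′ n
        E≡F′ n (s≤s n≤N) = *-cancelˡ ιa≢0 (begin
          ι a * E n
            ≡⟨ regularised-recurrence a n ⟩
          geom₂ a (pow 0) n + (geom₂ a E n - shift 1 (geom₂ a E) n)
            ≡⟨ cong (λ x → geom₂ a (pow 0) n + x)
                (Δ-local n (λ k k<n → geom₂-cong a k (λ j j≤k → E≡F j (ℕₚ.<-≤-trans (ℕₚ.≤-<-trans j≤k k<n) n≤N)))) ⟩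
          S
            ≡⟨ ℚₚ.*-identityˡ S ⟨
          1ℚ * S
            ≡⟨ cong (_* S) (÷₀-* 1ℚ ιa≢0) ⟨
          (1ℚ ÷₀ ι a) * ι a * S
            ≡⟨ solve 3 (λ i a s → i :* a :* s := a :* (i :* s)) refl (1ℚ ÷₀ ι a) (ι a) S ⟩
          ι a * F′ n ∎)
          where S = geom₂ a (pow 0) n + (geom₂ a F n - shift 1 (geom₂ a F) n)

    -- The recurrence expresses regularised a n through earlier terms only, so one
    -- application of it lengthens the range of agreement by one.
    regularised-PowerSum : ∀ {a} → ¬ (p ∣ a) → ∀ N →
      ∃[ F ] PowerSum p F × (∀ n → n < N → regularised a n ≡ F n)
    regularised-PowerSum p∤a zero    = (λ _ → 0ℚ) , PowerSum-zeros , λ n ()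
    regularised-PowerSum p∤a (suc N) =
      let F , F∈ , E≡F = regularised-PowerSum p∤a N in extend p∤a N F∈ E≡F

  -- Kummer and von Staudt congruences

  C*k!*[n∸k]! : ∀ {n k} → k ≤ n → (n C k) ℕ.* (k ! ℕ.* (n ∸ k) !) ≡ n !
  C*k!*[n∸k]! {n} {k} k≤n = trans (cong (ℕ._* (k ! ℕ.* (n ∸ k) !)) (nCk≡n!/k![n-k]! k≤n))
    (ℕ/.m/n*n≡m (∣-trans (∣-reflexive (ℕₚ.*-comm (k !) ((n ∸ k) !))) ([n∸k]!k!∣n! k≤n)))
    where instance _ = k ℕₚ.!* (n ∸ k) !≢0

  -- The binomial theorem modulo v²: (1 + v)^n = 1 + nv + v²h. The linear coefficient n is what
  -- later yields an extra factor p.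
  suc-^-expansion : ∀ v n → ∃[ h ] suc v ^ n ≡ suc (v ℕ.* (n ℕ.+ v ℕ.* h))
  suc-^-expansion v zero    = 0 , solve′ 1 (λ v → con′ 1 =′ con′ 1 +′ v *′ (v *′ con′ 0)) refl v
    where open ℕ-Solver renaming (solve to solve′; con to con′; _:=_ to _=′_; _:+_ to _+′_; _:*_ to _*′_)
  suc-^-expansion v (suc n) with suc-^-expansion v n
  ... | h , eq = h ℕ.+ (n ℕ.+ v ℕ.* h) , trans (cong (suc v ℕ.*_) eq)
    (solve′ 3 (λ v n h → (con′ 1 +′ v) *′ (con′ 1 +′ v *′ (n +′ v *′ h)) =′ con′ 1 +′ v *′
        (con′ 1 +′ n +′ v *′ (h +′ (n +′ v *′ h)))) refl v n h)
    where open ℕ-Solver renaming (solve to solve′; con to con′; _:=_ to _=′_; _:+_ to _+′_; _:*_ to _*′_)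

  ∣-^ : ∀ {p i} r {n} → p ∣ i → r ≤ n → p ^ r ∣ i ^ n
  ∣-^ zero    p∣i _         = 1∣ _
  ∣-^ (suc r) p∣i (s≤s r≤n) = *-pres-∣ p∣i (∣-^ r p∣i r≤n)

  module _ {p : ℕ} (pr : Prime p) where

    private
      instance
        p≢0 : ℕ.NonZero p
        p≢0 = prime⇒nonZero pr

      suc[p-1] : suc (p ∸ 1) ≡ p
      suc[p-1] = ℕₚ.suc-pred p

      instance
        p-1≢0 : ℕ.NonZero (p ∸ 1)
        p-1≢0 = ℕ.>-nonZero (ℕₚ.≤-pred (subst (2 ≤_) (sym suc[p-1]) (ℕ.nonTrivial⇒n>1 p {{prime⇒nonTrivial pr}})))

    ι-∈⇒∣ : ∀ k → ι k ∈ p ℤ₍ p ₎ → p ∣ k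
    ι-∈⇒∣ k k∈ = subst (_∣ k) (ℕₚ.*-identityʳ p)
      (fromℤ-∈⇒∣ pr 1 (ℤ.+ k) (subst (ι k ∈_ℤ₍ p ₎) (sym (ℕₚ.*-identityʳ p)) k∈))

    0<k<p⇒p∤k : ∀ {k} → k < p ∸ 1 → ¬ (p ∣ suc k)
    0<k<p⇒p∤k k<p-1 = >⇒∤ (subst (_ <_) suc[p-1] (s≤s k<p-1))

    p∤! : ∀ {k} → k < p → ¬ (p ∣ k !)
    p∤! {zero}  _   = p∤1 pr
    p∤! {suc k} k<p = p∤* pr (>⇒∤ k<p) (p∤! (ℕₚ.<-trans (ℕₚ.n<1+n k) k<p))

    p∣pC[1+k] : ∀ {k} → k < p ∸ 1 → p ∣ p C suc k
    p∣pC[1+k] {k} k<p-1 with euclidsLemma (p C suc k) (suc k ! ℕ.* (p ∸ suc k) !) pr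
      (subst (p ∣_) (sym (C*k!*[n∸k]! (ℕₚ.<⇒≤ k+1<p))) (subst (λ q → q ∣ q !) suc[p-1] (m∣m*n ((p ∸ 1) !))))
      where
      k+1<p : suc k < p
      k+1<p = subst (suc k <_) suc[p-1] (s≤s k<p-1)
    ... | inj₁ p∣C = p∣C
    ... | inj₂ p∣k!l! = contradiction p∣k!l! (p∤* pr (p∤! k+1<p)
        (p∤! (ℕₚ.∸-monoʳ-< {p} {suc k} {0} ℕ.z<s (ℕₚ.<⇒≤ k+1<p))))
      where
      k+1<p : suc k < p
      k+1<p = subst (suc k <_) suc[p-1] (s≤s k<p-1)

    -- The binomial coefficients strictly inside row p are divisible by p. The top entry F p has
    -- coefficient 1 and cancels, so integrality is asked only below p; this matters when F is the
    -- Bernoulli sequence.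
    shift-1-prime : ∀ {F} → (∀ k → k < p → F k ∈ 1 ℤ₍ p ₎) → shift 1 F p - (F 0 + F p) ∈ p ℤ₍ p ₎
    shift-1-prime {F} F∈ = subst (_∈ p ℤ₍ p ₎) (sym eq) (Σ<-∈ pr (p ∸ 1) term∈)
      where
      open ≡-Reasoning
      f : ℕ → ℚ
      f k = ι (p C k) * F k
      term∈ : ∀ k → k < p ∸ 1 → f (suc k) ∈ p ℤ₍ p ₎
      term∈ k k<p-1 = ∈-*ʳ pr (∣⇒ι-∈ pr (p∣pC[1+k] k<p-1)) (F∈ (suc k) (subst (suc k <_) suc[p-1] (s≤s k<p-1)))
      eq : shift 1 F p - (F 0 + F p) ≡ Σ< (p ∸ 1) (f ∘ suc)
      eq = begin
        shift 1 F p - (F 0 + F p)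
          ≡⟨ cong (_- (F 0 + F p)) (trans (shift-1-lower F p) (cong (λ q → Σ< q f + F p) (sym suc[p-1]))) ⟩
        Σ< (suc (p ∸ 1)) f + F p - (F 0 + F p)
          ≡⟨ cong (λ t → t + F p - (F 0 + F p)) (Σ<-head (p ∸ 1) f) ⟩
        1ℚ * F 0 + Σ< (p ∸ 1) (f ∘ suc) + F p - (F 0 + F p)
          ≡⟨ solve 3 (λ a b c → con 1ℚ :* a :+ b :+ c :- (a :+ c) := b) refl (F 0) (Σ< (p ∸ 1) (f ∘ suc)) (F p) ⟩
        Σ< (p ∸ 1) (f ∘ suc) ∎

    fermat : ∀ i → ι (i ^ p) - ι i ∈ p ℤ₍ p ₎
    fermat zero    = subst (λ q → ι (0 ^ q) - 0ℚ ∈ p ℤ₍ p ₎) suc[p-1] (0-∈ pr)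
    fermat (suc i) = subst (_∈ p ℤ₍ p ₎) eq (∈-+ pr (shift-1-prime {pow i} (λ k _ → ι-∈ pr (i ^ k))) (fermat i))
      where
      open ≡-Reasoning
      eq : shift 1 (pow i) p - (1ℚ + ι (i ^ p)) + (ι (i ^ p) - ι i) ≡ ι (suc i ^ p) - ι (suc i)
      eq = begin
        shift 1 (pow i) p - (1ℚ + ι (i ^ p)) + (ι (i ^ p) - ι i)
          ≡⟨ solve 3 (λ s x i → s :- (con 1ℚ :+ x) :+ (x :- i) := s :- (con 1ℚ :+ i)) refl (shift 1 (pow i) p)
              (ι (i ^ p)) (ι i) ⟩
        shift 1 (pow i) p - (1ℚ + ι i)
          ≡⟨ cong₂ _-_ (shift-pow 1 i p) (sym (ι-suc i)) ⟩
        ι (suc i ^ p) - ι (suc i) ∎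

    fermat-unit : ∀ {i} → ¬ (p ∣ i) → ∃[ v ] i ^ (p ∸ 1) ≡ suc v × p ∣ v
    fermat-unit {zero}  p∤i = contradiction (p ∣0) p∤i
    fermat-unit {suc b} p∤i = v , suc-^-pred b (p ∸ 1) , ι-∈⇒∣ v
        (∈-cancel-unit pr p∤i (subst (_∈ p ℤ₍ p ₎) eq (fermat (suc b))))
      where
      open ≡-Reasoning
      v = suc b ^ (p ∸ 1) ∸ 1
      i = ι (suc b)
      eq : ι (suc b ^ p) - i ≡ i * ι v
      eq = begin
        ι (suc b ^ p) - i                    ≡⟨ cong (λ q → ι (suc b ^ q) - i) suc[p-1] ⟨
        ι (suc b ^ suc (p ∸ 1)) - i          ≡⟨ cong (_- i) (ι-* (suc b) (suc b ^ (p ∸ 1))) ⟩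
        i * ι (suc b ^ (p ∸ 1)) - i          ≡⟨ cong (λ x → i * x - i)
            (trans (cong ι (suc-^-pred b (p ∸ 1))) (ι-suc v)) ⟩
        i * (1ℚ + ι v) - i                   ≡⟨ solve 2 (λ i v → i :* (con 1ℚ :+ v) :- i := i :* v) refl i (ι v) ⟩
        i * ι v                              ∎

    -- Each step raises 1 + v to the power p, giving 1 + v(p + vh); as p ∣ v, the second factor
    -- contributes one more p.
    euler : ∀ r {i} → ¬ (p ∣ i) → ∃[ v ] i ^ (p ^ r ℕ.* (p ∸ 1)) ≡ suc v × p ^ suc r ∣ v
    euler zero {i} p∤i with fermat-unit p∤i
    ... | v , eq , p∣v = v , trans (cong (i ^_) (ℕₚ.*-identityˡ (p ∸ 1))) eq , subst (_∣ v) (sym (ℕₚ.*-identityʳ p)) p∣v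
    euler (suc r) {i} p∤i with euler r p∤i
    ... | v , eq , pʳ∣v with suc-^-expansion v p
    ... | h , eq′ = v ℕ.* (p ℕ.+ v ℕ.* h) , i^≡ ,
        subst (_∣ v ℕ.* (p ℕ.+ v ℕ.* h)) (ℕₚ.*-comm (p ^ suc r) p)
          (*-pres-∣ pʳ∣v (∣m∣n⇒∣m+n ∣-refl (∣m⇒∣m*n h (∣-trans (m∣m*n (p ^ r)) pʳ∣v))))
      where
      open ≡-Reasoning
      T = p ^ r ℕ.* (p ∸ 1)
      i^≡ : i ^ (p ^ suc r ℕ.* (p ∸ 1)) ≡ suc (v ℕ.* (p ℕ.+ v ℕ.* h))
      i^≡ = begin
        i ^ (p ^ suc r ℕ.* (p ∸ 1)) ≡⟨ cong (i ^_) (trans (ℕₚ.*-assoc p (p ^ r) (p ∸ 1)) (ℕₚ.*-comm p T)) ⟩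
        i ^ (T ℕ.* p)               ≡⟨ ℕₚ.^-*-assoc i T p ⟨
        (i ^ T) ^ p                 ≡⟨ cong (_^ p) eq ⟩
        suc v ^ p                   ≡⟨ eq′ ⟩
        suc (v ℕ.* (p ℕ.+ v ℕ.* h)) ∎

    euler-multiple : ∀ r k {i} → ¬ (p ∣ i) → ∃[ v ] i ^ (p ^ r ℕ.* (p ∸ 1) ℕ.* k) ≡ suc v × p ^ suc r ∣ v
    euler-multiple r k {i} p∤i with euler r p∤i
    ... | v , eq , pʳ∣v with suc-^-expansion v k
    ... | h , eq′ = v ℕ.* (k ℕ.+ v ℕ.* h) ,
      trans (sym (ℕₚ.^-*-assoc i (p ^ r ℕ.* (p ∸ 1)) k)) (trans (cong (_^ k) eq) eq′) ,
      ∣m⇒∣m*n (k ℕ.+ v ℕ.* h) pʳ∣v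

    -- On a single power iⁿ: if p ∣ i, both powers vanish modulo p^(r+1) because the exponents are
    -- at least r + 1; otherwise the step is a multiple of φ(p^(r+1)) and Euler's theorem applies.
    PowerSum-periodic : ∀ r k n → suc r ≤ n → ∀ {F} → PowerSum p F →
      F (n ℕ.+ p ^ r ℕ.* (p ∸ 1) ℕ.* k) - F n ∈ p ^ suc r ℤ₍ p ₎
    PowerSum-periodic r k n r<n (power i) with p ∣? i
    ... | yes p∣i = ∈-- pr (∣⇒ι-∈ pr (∣-^ (suc r) p∣i (ℕₚ.m≤n⇒m≤n+o _ r<n))) (∣⇒ι-∈ pr (∣-^ (suc r) p∣i r<n))
    ... | no  p∤i with euler-multiple r k p∤i
    ... | v , eq , pʳ∣v = subst (_∈ p ^ suc r ℤ₍ p ₎) (sym eq′) (∈-*ˡ pr (ι-∈ pr (i ^ n)) (∣⇒ι-∈ pr pʳ∣v))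
      where
      open ≡-Reasoning
      M = p ^ r ℕ.* (p ∸ 1) ℕ.* k
      eq′ : ι (i ^ (n ℕ.+ M)) - ι (i ^ n) ≡ ι (i ^ n) * ι v
      eq′ = begin
        ι (i ^ (n ℕ.+ M)) - ι (i ^ n)           ≡⟨ cong (λ x → ι x - ι (i ^ n))
            (trans (ℕₚ.^-distribˡ-+-* i n M) (cong (i ^ n ℕ.*_) eq)) ⟩
        ι (i ^ n ℕ.* suc v) - ι (i ^ n)         ≡⟨ cong (_- ι (i ^ n))
            (trans (ι-* (i ^ n) (suc v)) (cong (ι (i ^ n) *_) (ι-suc v))) ⟩
        ι (i ^ n) * (1ℚ + ι v) - ι (i ^ n)      ≡⟨ solve 2 (λ x v → x :* (con 1ℚ :+ v) :- x := x :* v) refl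
            (ι (i ^ n)) (ι v) ⟩
        ι (i ^ n) * ι v                         ∎
    PowerSum-periodic r k n r<n (sum {F} {G} F∈ G∈) = subst (_∈ p ^ suc r ℤ₍ p ₎)
      (solve 4 (λ a b c d → (a :- b) :+ (c :- d) := (a :+ c) :- (b :+ d)) refl (F m) (F n) (G m) (G n))
      (∈-+ pr (PowerSum-periodic r k n r<n F∈) (PowerSum-periodic r k n r<n G∈))
      where m = n ℕ.+ p ^ r ℕ.* (p ∸ 1) ℕ.* k
    PowerSum-periodic r k n r<n (scale {c} {F} c∈ F∈) = subst (_∈ p ^ suc r ℤ₍ p ₎)
      (solve 3 (λ c a b → c :* (a :- b) := c :* a :- c :* b) refl c (F m) (F n))
      (∈-*ˡ pr c∈ (PowerSum-periodic r k n r<n F∈))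
      where m = n ℕ.+ p ^ r ℕ.* (p ∸ 1) ℕ.* k
    PowerSum-periodic r k n r<n (equal F≡G F∈) =
      subst (_∈ p ^ suc r ℤ₍ p ₎) (cong₂ _-_ (F≡G _) (F≡G n)) (PowerSum-periodic r k n r<n F∈)

    regularised-periodic : ∀ {a} → ¬ (p ∣ a) → ∀ r k n → suc r ≤ n →
      regularised a (n ℕ.+ p ^ r ℕ.* (p ∸ 1) ℕ.* k) - regularised a n ∈ p ^ suc r ℤ₍ p ₎
    regularised-periodic {a} p∤a r k n r<n =
      let m = n ℕ.+ p ^ r ℕ.* (p ∸ 1) ℕ.* k
          F , F∈ , E≡F = regularised-PowerSum pr p∤a (suc m)
      in subst (_∈ p ^ suc r ℤ₍ p ₎)
           (sym (cong₂ _-_ (E≡F m ℕₚ.≤-refl) (E≡F n (s≤s (ℕₚ.m≤m+n n (p ^ r ℕ.* (p ∸ 1) ℕ.* k))))))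
           (PowerSum-periodic r k n r<n F∈)

    -- The integral counterpart of `Δ-injective`: recovering Fₙ from (e^z - 1)F divides by n + 1, a
    -- unit at p as long as n + 1 < p.
    Δ-∈⇒∈ : ∀ {F m} → (∀ n → n < p ∸ 1 → shift 1 F (suc n) - F (suc n) ∈ m ℤ₍ p ₎) →
      ∀ n → n < p ∸ 1 → F n ∈ m ℤ₍ p ₎
    Δ-∈⇒∈ {F} {m} ΔF∈ n = below (suc n) n ℕₚ.≤-refl
      where
      step : ∀ n → n < p ∸ 1 → (∀ k → k < n → F k ∈ m ℤ₍ p ₎) → F n ∈ m ℤ₍ p ₎
      step n n<p-1 F∈ = ∈-cancel-unit pr (0<k<p⇒p∤k n<p-1) (subst (_∈ m ℤ₍ p ₎) eq
        (∈-- pr (ΔF∈ n n<p-1) (Σ<-∈ pr n (λ k k<n → ∈-*ˡ pr (ι-∈ pr (suc n C k)) (F∈ k k<n)))))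
        where
        s = Σ< n (λ k → ι (suc n C k) * F k)
        eq : shift 1 F (suc n) - F (suc n) - s ≡ ι (suc n) * F n
        eq = trans (cong (λ t → t - F (suc n) - s) (shift-1-lower₂ F n))
          (solve 3 (λ s x y → s :+ x :+ y :- y :- s := x) refl s (ι (suc n) * F n) (F (suc n)))
      below : ∀ m′ n → n < m′ → n < p ∸ 1 → F n ∈ m ℤ₍ p ₎
      below (suc m′) n n<m n<p-1 = step n n<p-1 (λ k k<n →
        below m′ k (ℕₚ.<-≤-trans k<n (ℕₚ.≤-pred n<m)) (ℕₚ.<-trans k<n n<p-1))

    B-∈ : ∀ n → n < p ∸ 1 → B n ∈ 1 ℤ₍ p ₎
    B-∈ = Δ-∈⇒∈ λ n _ → subst (_∈ 1 ℤ₍ p ₎)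
      (sym (trans (cong (_- B (suc n)) (shift-1-B (suc n)))
          (solve 2 (λ x y → x :+ y :- x := y) refl (B (suc n)) (⟨z⟩ (pow 0) (suc n)))))
      (∈-*ˡ pr (ι-∈ pr (suc n)) (ι-∈ pr (0 ^ n)))

    -- (x - 1)[p](x) = x^p - 1 at x = e^z has coefficients p^(n+1) in positive degree, all divisible
    -- by p; the factor e^z - 1 is then removed.
    power-sum-∈ : ∀ n → n < p ∸ 1 → geom p (pow 0) n ∈ p ℤ₍ p ₎
    power-sum-∈ = Δ-∈⇒∈ λ n _ → subst (_∈ p ℤ₍ p ₎) (sym (eq n)) (∣⇒ι-∈ pr (m∣m*n (p ^ n)))
      where
      open ≡-Reasoning
      eq : ∀ n → shift 1 (geom p (pow 0)) (suc n) - geom p (pow 0) (suc n) ≡ pow p (suc n)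
      eq n = begin
        s - g               ≡⟨ solve 2 (λ s g → s :- g := s :+ con 0ℚ :- g) refl s g ⟩
        s + 0ℚ - g          ≡⟨ cong (_- g) (shift-1-geom p (pow 0) (suc n)) ⟩
        g + shift p (pow 0) (suc n) - g ≡⟨ solve 2 (λ x y → x :+ y :- x := y) refl g _ ⟩
        shift p (pow 0) (suc n) ≡⟨ shift-pow p 0 (suc n) ⟩
        pow (p ℕ.+ 0) (suc n)   ≡⟨ cong (λ q → pow q (suc n)) (ℕₚ.+-identityʳ p) ⟩
        pow p (suc n)       ∎
        where
        s = shift 1 (geom p (pow 0)) (suc n)
        g = geom p (pow 0) (suc n)

    -- If a^(l+1) ≡ 1 held for every 1 ≤ a < p, the sum of these powers would be p - 1 modulo p,
    -- whereas it vanishes modulo p. This takes the place of a primitive root.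
    non-root : ∀ l → suc l < p ∸ 1 → ∃[ b ] ¬ (p ∣ suc b) × ¬ (p ∣ suc b ^ suc l ∸ 1)
    non-root l l<p-1 with ℕₚ.anyUpTo? (λ b → ¬? (p ∣? suc b ^ suc l ∸ 1)) (p ∸ 1)
    ... | yes (b , b<p-1 , p∤) = b , 0<k<p⇒p∤k b<p-1 , p∤
    ... | no  none = contradiction (ι-∈⇒∣ (p ∸ 1) (subst (_∈ p ℤ₍ p ₎)
          (solve 2 (λ g q → g :- (g :- q) := q) refl (geom p (pow 0) (suc l)) (ι (p ∸ 1)))
          (∈-- pr (power-sum-∈ (suc l) l<p-1) total))) p∤p-1
      where
      p∤p-1 : ¬ (p ∣ p ∸ 1)
      p∤p-1 = >⇒∤ {{ℕ.>-nonZero (ℕₚ.<-trans ℕ.z<s l<p-1)}} (ℕₚ.≤-reflexive suc[p-1])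
      -- `geom (suc m)` sums over 0 ≤ i ≤ m; the term i = 0 vanishes because the exponent is
      -- positive, leaving m terms congruent to 1.
      partial : ∀ m → m ≤ p ∸ 1 → geom (suc m) (pow 0) (suc l) - ι m ∈ p ℤ₍ p ₎
      partial zero    _     = subst (_∈ p ℤ₍ p ₎) (sym (cong (λ x → 0ℚ + x - 0ℚ) (shift-0 (pow 0) (suc l)))) (0-∈ pr)
      partial (suc m) m<p-1 = subst (_∈ p ℤ₍ p ₎) eq′ (∈-+ pr (partial m (ℕₚ.<⇒≤ m<p-1)) (∣⇒ι-∈ pr p∣v))
        where
        open ≡-Reasoning
        v = suc m ^ suc l ∸ 1
        g = geom (suc m) (pow 0) (suc l)
        p∣v : p ∣ v
        p∣v = decidable-stable (p ∣? v) (λ p∤v → none (m , m<p-1 , p∤v))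
        eq′ : g - ι m + ι v ≡ g + shift (suc m) (pow 0) (suc l) - ι (suc m)
        eq′ = begin
          g - ι m + ι v
            ≡⟨ solve 3 (λ g m v → g :- m :+ v := g :+ (con 1ℚ :+ v) :- (con 1ℚ :+ m)) refl g (ι m) (ι v) ⟩
          g + (1ℚ + ι v) - (1ℚ + ι m)
            ≡⟨ cong₂ (λ x y → g + x - y) (trans (sym (ι-suc v)) (cong ι (sym (suc-^-pred m (suc l))))) (sym (ι-suc m)) ⟩
          g + ι (suc m ^ suc l) - ι (suc m)
            ≡⟨ cong (λ x → g + x - ι (suc m))
                (trans (shift-pow (suc m) 0 (suc l)) (cong (λ q → pow q (suc l)) (ℕₚ.+-identityʳ (suc m)))) ⟨
          g + shift (suc m) (pow 0) (suc l) - ι (suc m) ∎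
      total : geom p (pow 0) (suc l) - ι (p ∸ 1) ∈ p ℤ₍ p ₎
      total = subst (λ q → geom q (pow 0) (suc l) - ι (p ∸ 1) ∈ p ℤ₍ p ₎) suc[p-1] (partial (p ∸ 1) ℕₚ.≤-refl)

    non-root-periodic : ∀ {b} → ¬ (p ∣ suc b) → ∀ l k →
      ¬ (p ∣ suc b ^ l ∸ 1) → ¬ (p ∣ suc b ^ (l ℕ.+ (p ∸ 1) ℕ.* k) ∸ 1)
    non-root-periodic {b} p∤a l k p∤aˡ-1 p∣ =
      let v , eq , p∣v = euler-multiple 0 k p∤a
      in p∤aˡ-1 (∣m+n∣m⇒∣n (subst (p ∣_) (eq′ v eq) p∣) (∣n⇒∣m*n x (subst (_∣ v) (ℕₚ.*-identityʳ p) p∣v)))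
      where
      open ≡-Reasoning
      x = suc b ^ l
      eq′ : ∀ v → suc b ^ (p ^ 0 ℕ.* (p ∸ 1) ℕ.* k) ≡ suc v → suc b ^ (l ℕ.+ (p ∸ 1) ℕ.* k) ∸ 1 ≡ x ℕ.* v ℕ.+ (x ∸ 1)
      eq′ v eq = begin
        suc b ^ (l ℕ.+ (p ∸ 1) ℕ.* k) ∸ 1
          ≡⟨ cong (_∸ 1) (ℕₚ.^-distribˡ-+-* (suc b) l ((p ∸ 1) ℕ.* k)) ⟩
        x ℕ.* suc b ^ ((p ∸ 1) ℕ.* k) ∸ 1
          ≡⟨ cong (λ t → x ℕ.* t ∸ 1) (trans (cong (λ q → suc b ^ (q ℕ.* k)) (sym (ℕₚ.*-identityˡ (p ∸ 1)))) eq) ⟩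
        x ℕ.* suc v ∸ 1
          ≡⟨ cong (_∸ 1) (trans (ℕₚ.*-suc x v) (ℕₚ.+-comm x (x ℕ.* v))) ⟩
        x ℕ.* v ℕ.+ x ∸ 1
          ≡⟨ ℕₚ.+-∸-assoc (x ℕ.* v) (ℕₚ.m^n>0 (suc b) l) ⟩
        x ℕ.* v ℕ.+ (x ∸ 1) ∎

    ∈-neg⁻¹ : ∀ {N} y → - y ∈ N ℤ₍ p ₎ → y ∈ N ℤ₍ p ₎
    ∈-neg⁻¹ {N} y y∈ = subst (_∈ N ℤ₍ p ₎) (solve 1 (λ y → :- (:- y) := y) refl y) (∈-neg pr y∈)

    regularised-∈ : ∀ b n {M N} → ι (suc b ^ suc n ∸ 1) ∈ M ℤ₍ p ₎ → B/ (suc n) ∈ N ℤ₍ p ₎ →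
      regularised (suc b) n ∈ M ℕ.* N ℤ₍ p ₎
    regularised-∈ b n {M} {N} c∈ x∈ = subst (_∈ M ℕ.* N ℤ₍ p ₎) (sym (regularised-suc b n))
      (∈-neg pr {x = ι (suc b ^ suc n ∸ 1) * B/ (suc n)} (∈-* pr {x = ι (suc b ^ suc n ∸ 1)} {y = B/ (suc n)} c∈ x∈))

    regularised-∈⁻¹ : ∀ b n {N} → regularised (suc b) n ∈ N ℤ₍ p ₎ → ι (suc b ^ suc n ∸ 1) * B/ (suc n) ∈ N ℤ₍ p ₎
    regularised-∈⁻¹ b n {N} e∈ = ∈-neg⁻¹ (ι (suc b ^ suc n ∸ 1) * B/ (suc n))
        (subst (_∈ N ℤ₍ p ₎) (regularised-suc b n) e∈)

    ∈-difference : ∀ {N x y} → x - y ∈ N ℤ₍ p ₎ → y ∈ N ℤ₍ p ₎ → x ∈ N ℤ₍ p ₎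
    ∈-difference {N} {x} {y} x-y∈ y∈ = subst (_∈ N ℤ₍ p ₎) (solve 2 (λ x y → (x :- y) :+ y := x) refl x y)
        (∈-+ pr x-y∈ y∈)

    ∈-difference′ : ∀ {N x y} → x - y ∈ N ℤ₍ p ₎ → x ∈ N ℤ₍ p ₎ → y ∈ N ℤ₍ p ₎
    ∈-difference′ {N} {x} {y} x-y∈ x∈ = subst (_∈ N ℤ₍ p ₎) (solve 2 (λ x y → x :- (x :- y) := y) refl x y)
        (∈-- pr x∈ x-y∈)

    -- The regularised values at the two indices agree modulo p^(r+1), and at each index the factor
    -- a^m - 1 is a unit that can be removed.
    kummer-by : ∀ r n k b → suc r ≤ n → ¬ (p ∣ suc b) → ¬ (p ∣ suc b ^ suc n ∸ 1) →
      ¬ (p ∣ suc b ^ suc (n ℕ.+ p ^ r ℕ.* (p ∸ 1) ℕ.* k) ∸ 1) →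
      B/ (suc n) ∈ p ^ suc r ℤ₍ p ₎ ⇔ B/ (suc n ℕ.+ p ^ r ℕ.* (p ∸ 1) ℕ.* k) ∈ p ^ suc r ℤ₍ p ₎
    kummer-by r n k b r<n p∤a p∤ p∤′ = mk⇔
      (λ x∈ → ∈-cancel-unit pr p∤′ (regularised-∈⁻¹ b m (∈-difference periodic (E∈ n x∈))))
      (λ x∈ → ∈-cancel-unit pr p∤ (regularised-∈⁻¹ b n (∈-difference′ periodic (E∈ m x∈))))
      where
      m = n ℕ.+ p ^ r ℕ.* (p ∸ 1) ℕ.* k
      periodic : regularised (suc b) m - regularised (suc b) n ∈ p ^ suc r ℤ₍ p ₎
      periodic = regularised-periodic p∤a r k n r<n
      E∈ : ∀ n {N} → B/ (suc n) ∈ N ℤ₍ p ₎ → regularised (suc b) n ∈ N ℤ₍ p ₎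
      E∈ n {N} x∈ = subst (regularised (suc b) n ∈_ℤ₍ p ₎) (ℕₚ.*-identityˡ N)
          (regularised-∈ b n (ι-∈ pr (suc b ^ suc n ∸ 1)) x∈)

    -- The base is chosen by `non-root` for the residue of m modulo p - 1, nonzero by hypothesis;
    -- both indices lie in this residue class, so one base serves both.
    kummer : ∀ r m k → suc r < m → ¬ (p ∸ 1 ∣ m) →
      B/ m ∈ p ^ suc r ℤ₍ p ₎ ⇔ B/ (m ℕ.+ p ^ r ℕ.* (p ∸ 1) ℕ.* k) ∈ p ^ suc r ℤ₍ p ₎
    kummer r (suc n) k (s≤s r<n) p-1∤m =
      let b , p∤a , p∤aˡ-1 = non-root l (subst (_< p ∸ 1) (sym l+1≡) (ℕ/.m%n<n (suc n) (p ∸ 1)))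
          p∤aᵐ-1 = subst (λ e → ¬ (p ∣ suc b ^ e ∸ 1)) (sym n≡) (non-root-periodic p∤a (suc l) q p∤aˡ-1)
      in kummer-by r n k b r<n p∤a p∤aᵐ-1
           (subst (λ e → ¬ (p ∣ suc b ^ (suc n ℕ.+ e) ∸ 1)) (sym M≡)
               (non-root-periodic p∤a (suc n) (p ^ r ℕ.* k) p∤aᵐ-1))
      where
      M = p ^ r ℕ.* (p ∸ 1) ℕ.* k
      q = suc n ℕ/./ (p ∸ 1)
      l = suc n ℕ/.% (p ∸ 1) ∸ 1
      l+1≡ : suc l ≡ suc n ℕ/.% (p ∸ 1)
      l+1≡ = ℕₚ.m+[n∸m]≡n (ℕₚ.n≢0⇒n>0 λ eq → p-1∤m (m%n≡0⇒n∣m (suc n) (p ∸ 1) eq))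
      n≡ : suc n ≡ suc l ℕ.+ (p ∸ 1) ℕ.* q
      n≡ = trans (ℕ/.m≡m%n+[m/n]*n (suc n) (p ∸ 1)) (cong₂ ℕ._+_ (sym l+1≡) (ℕₚ.*-comm q (p ∸ 1)))
      M≡ : M ≡ (p ∸ 1) ℕ.* (p ^ r ℕ.* k)
      M≡ = trans (cong (ℕ._* k) (ℕₚ.*-comm (p ^ r) (p ∸ 1))) (ℕₚ.*-assoc (p ∸ 1) (p ^ r) k)

    kummer-mod-p : ∀ m k → 1 < m → ¬ (p ∸ 1 ∣ m) →
      B/ m ∈ p ℤ₍ p ₎ ⇔ B/ (m ℕ.+ (p ∸ 1) ℕ.* k) ∈ p ℤ₍ p ₎
    kummer-mod-p m k 1<m p-1∤m = subst₂ (λ N e → B/ m ∈ N ℤ₍ p ₎ ⇔ B/ (m ℕ.+ e ℕ.* k) ∈ N ℤ₍ p ₎)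
      (ℕₚ.*-identityʳ p) (ℕₚ.*-identityˡ (p ∸ 1)) (kummer 0 m k 1<m p-1∤m)

    -- If B_{p-1} were p-integral, all B_k with k < p would be, and `shift-1-prime` would make the
    -- coefficient of z^p in (e^z - 1)B, which is 0, congruent to B₀ = 1.
    B-p-1-∉ : 2 < p → ¬ (B (p ∸ 1) ∈ 1 ℤ₍ p ₎)
    B-p-1-∉ 2<p B∈ = p∤1 pr (ι-∈⇒∣ 1 (subst (_∈ p ℤ₍ p ₎) eq (∈-neg pr (shift-1-prime {B} B-∈-all))))
      where
      open ≡-Reasoning
      p≡ : p ≡ 2 ℕ.+ (p ∸ 2)
      p≡ = sym (ℕₚ.m+[n∸m]≡n (ℕₚ.<⇒≤ 2<p))
      B-∈-all : ∀ k → k < p → B k ∈ 1 ℤ₍ p ₎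
      B-∈-all k k<p with ℕₚ.m≤n⇒m<n∨m≡n (ℕₚ.≤-pred (subst (suc k ≤_) (sym suc[p-1]) k<p))
      ... | inj₁ k<p-1 = B-∈ k k<p-1
      ... | inj₂ k≡p-1 = subst (λ j → B j ∈ 1 ℤ₍ p ₎) (sym k≡p-1) B∈
      ⟨z⟩≡0 : ⟨z⟩ (pow 0) p ≡ 0ℚ
      ⟨z⟩≡0 = trans (cong (⟨z⟩ (pow 0)) p≡) (ℚₚ.*-zeroʳ (ι (2 ℕ.+ (p ∸ 2))))
      eq : - (shift 1 B p - (1ℚ + B p)) ≡ 1ℚ
      eq = begin
        - (shift 1 B p - (1ℚ + B p))        ≡⟨ cong (λ t → - (t - (1ℚ + B p)))
            (trans (shift-1-B p) (cong (λ x → B p + x) ⟨z⟩≡0)) ⟩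
        - (B p + 0ℚ - (1ℚ + B p))           ≡⟨ solve 1 (λ b → :- (b :+ con 0ℚ :- (con 1ℚ :+ b)) := con 1ℚ) refl (B p) ⟩
        1ℚ                                  ∎

    p∣[1+p]^-1 : ∀ m → p ∣ suc p ^ m ∸ 1
    p∣[1+p]^-1 m with suc-^-expansion p m
    ... | h , eq = subst (λ t → p ∣ t ∸ 1) (sym eq) (m∣m*n (m ℕ.+ p ℕ.* h))

    -- Taking a = 1 + p makes 1 - aᵐ divisible by p, but not by p² for m = p - 1.
    B/-∉ : 2 < p → ∀ k → ¬ (B/ ((p ∸ 1) ℕ.+ (p ∸ 1) ℕ.* k) ∈ 1 ℤ₍ p ₎)
    B/-∉ 2<p k B/∈ = B-p-1-∉ 2<p (subst (λ j → B j ∈ 1 ℤ₍ p ₎) n+1≡p-1 Bₙ₊₁∈)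
      where
      open ≡-Reasoning
      n = p ∸ 2
      n+1≡p-1 : suc n ≡ p ∸ 1
      n+1≡p-1 = sym (ℕₚ.+-∸-assoc 1 (ℕₚ.<⇒≤ 2<p))
      M = p ^ 0 ℕ.* (p ∸ 1) ℕ.* k
      a = suc p
      p∤a : ¬ (p ∣ a)
      p∤a p∣a = p∤1 pr (∣m+n∣m⇒∣n (subst (p ∣_) (ℕₚ.+-comm 1 p) p∣a) ∣-refl)
      index : (p ∸ 1) ℕ.+ (p ∸ 1) ℕ.* k ≡ suc (n ℕ.+ M)
      index = cong₂ ℕ._+_ (sym n+1≡p-1) (cong (ℕ._* k) (sym (ℕₚ.*-identityˡ (p ∸ 1))))
      E∈ : regularised a (n ℕ.+ M) ∈ p ^ 1 ℤ₍ p ₎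
      E∈ = regularised-∈ p (n ℕ.+ M) (∣⇒ι-∈ pr (p∣[1+p]^-1 (suc (n ℕ.+ M)))) (subst (λ j → B/ j ∈ 1 ℤ₍ p ₎) index B/∈)
      -- Periodicity carries divisibility by p from the given multiple of p - 1 down to p - 1
      -- itself.
      Eₙ∈ : ι (a ^ suc n ∸ 1) * B/ (suc n) ∈ p ^ 1 ℤ₍ p ₎
      Eₙ∈ = regularised-∈⁻¹ p n (∈-difference′ (regularised-periodic p∤a 0 k n
        (ℕₚ.≤-pred (subst (2 ≤_) (sym n+1≡p-1) (ℕₚ.≤-pred (subst (3 ≤_) (sym suc[p-1]) 2<p))))) E∈)
      -- a^(n+1) - 1 = p g with g ≡ n + 1 = p - 1 modulo p, so g is a unit and exactly one factor p
      -- is divided out.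
      h = proj₁ (suc-^-expansion p (suc n))
      g = suc n ℕ.+ p ℕ.* h
      a^≡ : ι (a ^ suc n ∸ 1) * B/ (suc n) ≡ ι p * (ι g * B/ (suc n))
      a^≡ = begin
        ι (a ^ suc n ∸ 1) * B/ (suc n)  ≡⟨ cong (λ t → ι (t ∸ 1) * B/ (suc n)) (proj₂ (suc-^-expansion p (suc n))) ⟩
        ι (p ℕ.* g) * B/ (suc n)        ≡⟨ cong (_* B/ (suc n)) (ι-* p g) ⟩
        ι p * ι g * B/ (suc n)          ≡⟨ ℚₚ.*-assoc (ι p) (ι g) (B/ (suc n)) ⟩
        ι p * (ι g * B/ (suc n))        ∎
      p∤g : ¬ (p ∣ g)
      p∤g p∣g = 0<k<p⇒p∤k (subst (n <_) n+1≡p-1 (ℕₚ.n<1+n n))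
        (∣m+n∣m⇒∣n (subst (p ∣_) (ℕₚ.+-comm (suc n) (p ℕ.* h)) p∣g) (m∣m*n h))
      B/ₙ₊₁∈ : B/ (suc n) ∈ 1 ℤ₍ p ₎
      B/ₙ₊₁∈ = ∈-cancel-unit pr p∤g (∈-cancel pr p (ℕ.≢-nonZero⁻¹ p) (subst (_∈ p ^ 1 ℤ₍ p ₎) a^≡ Eₙ∈))
      Bₙ₊₁∈ : B (suc n) ∈ 1 ℤ₍ p ₎
      Bₙ₊₁∈ = subst (_∈ 1 ℤ₍ p ₎) (÷₀-* (B (suc n)) (ι-suc≢0 n)) (∈-*ʳ pr B/ₙ₊₁∈ (ι-∈ pr (suc n)))

  -- The quotient of numerators

  x÷₀0 : ∀ x {y} → y ≡ 0ℚ → x ÷₀ y ≡ 0ℚ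
  x÷₀0 x refl = refl

  ↥-↧-coprime : ∀ x → Coprime ∣ ↥ x ∣ (↧ₙ x)
  ↥-↧-coprime (mkℚ u w-1 c) = recompute c

  coprime-∣ˡ : ∀ {d m n} → d ∣ m → Coprime m n → Coprime d n
  coprime-∣ˡ d∣m c (e∣d , e∣n) = c (∣-trans e∣d d∣m , e∣n)

  coprime-*ˡ : ∀ {m n k} → Coprime m k → Coprime n k → Coprime (m ℕ.* n) k
  coprime-*ˡ c c′ {d} (d∣mn , d∣k) = c′ (coprime-divisor (coprime-∣ˡ d∣k (Coprimality.sym c)) d∣mn , d∣k)

  -- To be read with x = B_m/m, y = B_m/(m(m - 1)) and c = m - 1. In lowest terms x = u/w and y =
  -- v/z, and everything below comes from zu = wcv.
  module _ {x y : ℚ} (c : ℕ) (c*y≡x : ι c * y ≡ x) where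

    private
      u v : ℤ
      u = ↥ x
      v = ↥ y
      w z : ℕ
      w = ↧ₙ x
      z = ↧ₙ y

    cross-multiplied : ℤ.+ z ℤ.* u ≡ ℤ.+ (w ℕ.* c) ℤ.* v
    cross-multiplied = fromℤ-injective (ℤ.+ z ℤ.* u) (ℤ.+ (w ℕ.* c) ℤ.* v) (begin
      fromℤ (ℤ.+ z ℤ.* u)            ≡⟨ fromℤ-* (ℤ.+ z) u ⟩
      ι z * fromℤ u                  ≡⟨ cong (ι z *_) (↧*≡↥ x) ⟨
      ι z * (ι w * x)                ≡⟨ cong (λ t → ι z * (ι w * t)) c*y≡x ⟨
      ι z * (ι w * (ι c * y))        ≡⟨ solve 4 (λ z w c y → z :* (w :* (c :* y)) := w :* c :* (z :* y)) refl
          (ι z) (ι w) (ι c) y ⟩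
      ι w * ι c * (ι z * y)          ≡⟨ cong₂ _*_ (sym (ι-* w c)) (↧*≡↥ y) ⟩
      ι (w ℕ.* c) * fromℤ v          ≡⟨ fromℤ-* (ℤ.+ (w ℕ.* c)) v ⟨
      fromℤ (ℤ.+ (w ℕ.* c) ℤ.* v)    ∎)
      where open ≡-Reasoning

    cross-multiplied-ℕ : z ℕ.* ∣ u ∣ ≡ w ℕ.* c ℕ.* ∣ v ∣
    cross-multiplied-ℕ = trans (sym (ℤₚ.abs-* (ℤ.+ z) u))
        (trans (cong ∣_∣ cross-multiplied) (ℤₚ.abs-* (ℤ.+ (w ℕ.* c)) v))

    module _ {N : ℕ} (N≢0 : N ≢ 0) (ratio≡N : fromℤ u ÷₀ fromℤ v ≡ ι N) where

      private
        v≢0 : v ≢ ℤ.0ℤ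
        v≢0 v≡0 = ι≢0 N N≢0 (trans (sym ratio≡N) (x÷₀0 (fromℤ u) (cong fromℤ v≡0)))

        ∣u∣≡N*∣v∣ : ∣ u ∣ ≡ N ℕ.* ∣ v ∣
        ∣u∣≡N*∣v∣ = trans (cong ∣_∣ (fromℤ-injective u (ℤ.+ N ℤ.* v) (begin
          fromℤ u                          ≡⟨ ÷₀-* (fromℤ u) (λ eq → v≢0 (fromℤ-injective v ℤ.0ℤ eq)) ⟨
          (fromℤ u ÷₀ fromℤ v) * fromℤ v   ≡⟨ cong (_* fromℤ v) ratio≡N ⟩
          ι N * fromℤ v                    ≡⟨ fromℤ-* (ℤ.+ N) v ⟨
          fromℤ (ℤ.+ N ℤ.* v)              ∎))) (ℤₚ.abs-* (ℤ.+ N) v)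
          where open ≡-Reasoning

        z*N≡w*c : z ℕ.* N ≡ w ℕ.* c
        z*N≡w*c = ℕₚ.*-cancelʳ-≡ (z ℕ.* N) (w ℕ.* c) ∣ v ∣ {{ℕ.≢-nonZero λ eq → v≢0 (ℤₚ.∣i∣≡0⇒i≡0 eq)}}
          (trans (ℕₚ.*-assoc z N ∣ v ∣) (trans (cong (z ℕ.*_) (sym ∣u∣≡N*∣v∣)) cross-multiplied-ℕ))

      -- From u = Nv follows zN = wc; N divides u, hence is prime to w, hence divides c.
      ratio-∣ : N ∣ c
      ratio-∣ = coprime-divisor
        (coprime-∣ˡ (divides ∣ v ∣ (trans ∣u∣≡N*∣v∣ (ℕₚ.*-comm N ∣ v ∣))) (↥-↧-coprime x))
        (divides z (sym z*N≡w*c))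

      -- Here z = we, so q ∣ z. If q also divided u = Nv, it would divide v, and v/z would not be in
      -- lowest terms.
      ratio-maximal : ∀ {q e} → Prime q → ¬ (q ∣ N) → q ∣ e → c ≡ N ℕ.* e → ¬ (q ∣num x)
      ratio-maximal {q} {e} q-prime q∤N q∣e c≡ q∣u = ¬prime[1] (subst Prime (↥-↧-coprime y (q∣v , q∣z)) q-prime)
        where
        open ≡-Reasoning
        z≡w*e : z ≡ w ℕ.* e
        z≡w*e = ℕₚ.*-cancelʳ-≡ z (w ℕ.* e) N {{ℕ.≢-nonZero N≢0}} (begin
          z ℕ.* N           ≡⟨ z*N≡w*c ⟩
          w ℕ.* c           ≡⟨ cong (w ℕ.*_) (trans c≡ (ℕₚ.*-comm N e)) ⟩
          w ℕ.* (e ℕ.* N)   ≡⟨ ℕₚ.*-assoc w e N ⟨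
          w ℕ.* e ℕ.* N     ∎)
        q∣z : q ∣ z
        q∣z = subst (q ∣_) (sym z≡w*e) (∣n⇒∣m*n w q∣e)
        q∣v : q ∣ ∣ v ∣
        q∣v with euclidsLemma N ∣ v ∣ q-prime (subst (q ∣_) ∣u∣≡N*∣v∣ q∣u)
        ... | inj₁ q∣N = contradiction q∣N q∤N
        ... | inj₂ q∣v = q∣v

    -- With u = Nu′ up to sign, zu′ = wev in absolute values. u′ is prime to w and e, so it divides
    -- v; v is prime to z, so it divides u′. Nonzero u keeps the divisor v away from the default
    -- value of division.
    ratio≡ : ∀ {N e} → N ≢ 0 → ∣ u ∣ ≢ 0 → N ∣num x → c ≡ N ℕ.* e → Coprime ∣ u ∣ e →
      fromℤ u ÷₀ fromℤ v ≡ ι N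
    ratio≡ {N} {e} N≢0 u≢0 (divides u′ ∣u∣≡) c≡ u⊥e = begin
      fromℤ u ÷₀ fromℤ v                   ≡⟨ cong (λ t → fromℤ t ÷₀ fromℤ v) u≡N*v ⟩
      fromℤ (ℤ.+ N ℤ.* v) ÷₀ fromℤ v       ≡⟨ cong (_÷₀ fromℤ v) (fromℤ-* (ℤ.+ N) v) ⟩
      (ι N * fromℤ v) ÷₀ fromℤ v           ≡⟨ *-÷₀ (ι N) (λ eq → v≢0 (cong ∣_∣ (fromℤ-injective v ℤ.0ℤ eq))) ⟩
      ι N                                  ∎
      where
      open ≡-Reasoning
      instance
        _ = ℕ.≢-nonZero N≢0
      zu′≡ : z ℕ.* u′ ≡ w ℕ.* e ℕ.* ∣ v ∣
      zu′≡ = ℕₚ.*-cancelʳ-≡ (z ℕ.* u′) (w ℕ.* e ℕ.* ∣ v ∣) N (begin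
        z ℕ.* u′ ℕ.* N                ≡⟨ ℕₚ.*-assoc z u′ N ⟩
        z ℕ.* (u′ ℕ.* N)              ≡⟨ cong (z ℕ.*_) ∣u∣≡ ⟨
        z ℕ.* ∣ u ∣                   ≡⟨ cross-multiplied-ℕ ⟩
        w ℕ.* c ℕ.* ∣ v ∣             ≡⟨ cong (λ t → w ℕ.* t ℕ.* ∣ v ∣) c≡ ⟩
        w ℕ.* (N ℕ.* e) ℕ.* ∣ v ∣     ≡⟨ solve′ 4
            (λ w N e v → w *′ (N *′ e) *′ v =′ w *′ e *′ v *′ N) refl w N e ∣ v ∣ ⟩
        w ℕ.* e ℕ.* ∣ v ∣ ℕ.* N       ∎)
        where open ℕ-Solver renaming (solve to solve′; _:=_ to _=′_; _:*_ to _*′_)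
      u′∣u : u′ ∣ ∣ u ∣
      u′∣u = divides N (trans ∣u∣≡ (ℕₚ.*-comm u′ N))
      u′∣v : u′ ∣ ∣ v ∣
      u′∣v = coprime-divisor
        (Coprimality.sym (coprime-*ˡ (Coprimality.sym (coprime-∣ˡ u′∣u (↥-↧-coprime x)))
            (Coprimality.sym (coprime-∣ˡ u′∣u u⊥e))))
        (divides z (sym zu′≡))
      v∣u′ : ∣ v ∣ ∣ u′
      v∣u′ = coprime-divisor (↥-↧-coprime y) (divides (w ℕ.* e) zu′≡)
      v≡u′ : ∣ v ∣ ≡ u′
      v≡u′ = ∣-antisym v∣u′ u′∣v
      v≢0 : ∣ v ∣ ≢ 0
      v≢0 v≡0 = u≢0 (trans ∣u∣≡ (cong (ℕ._* N) (trans (sym v≡u′) v≡0)))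
      z≡ : z ≡ w ℕ.* e
      z≡ = ℕₚ.*-cancelʳ-≡ z (w ℕ.* e) ∣ v ∣ {{ℕ.≢-nonZero v≢0}} (trans (cong (z ℕ.*_) v≡u′) zu′≡)
      wc≡zN : w ℕ.* c ≡ z ℕ.* N
      wc≡zN = trans (cong (w ℕ.*_) (trans c≡ (ℕₚ.*-comm N e))) (trans (sym (ℕₚ.*-assoc w e N)) (cong (ℕ._* N) (sym z≡)))
      -- So far only absolute values are compared; cancelling the positive z in the signed equation
      -- settles the sign.
      u≡N*v : u ≡ ℤ.+ N ℤ.* v
      u≡N*v = ℤₚ.*-cancelˡ-≡ (ℤ.+ z) u (ℤ.+ N ℤ.* v) (begin
        ℤ.+ z ℤ.* u                    ≡⟨ cross-multiplied ⟩
        ℤ.+ (w ℕ.* c) ℤ.* v            ≡⟨ cong (λ t → ℤ.+ t ℤ.* v) wc≡zN ⟩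
        ℤ.+ (z ℕ.* N) ℤ.* v            ≡⟨ cong (ℤ._* v) (ℤₚ.pos-* z N) ⟩
        ℤ.+ z ℤ.* ℤ.+ N ℤ.* v          ≡⟨ ℤₚ.*-assoc (ℤ.+ z) (ℤ.+ N) v ⟩
        ℤ.+ z ℤ.* (ℤ.+ N ℤ.* v)        ∎)

  ÷₀-÷₀ : ∀ b m c → m ≢ 0 → c ≢ 0 → ι c * (b ÷₀ ι (m ℕ.* c)) ≡ b ÷₀ ι m
  ÷₀-÷₀ b m c m≢0 c≢0 = *-cancelˡ (ι≢0 m m≢0) (begin
    ι m * (ι c * y)     ≡⟨ solve 3 (λ m c y → m :* (c :* y) := y :* (m :* c)) refl (ι m) (ι c) y ⟩
    y * (ι m * ι c)     ≡⟨ cong (y *_) (ι-* m c) ⟨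
    y * ι (m ℕ.* c)     ≡⟨ ÷₀-* b (ι≢0 (m ℕ.* c) (λ eq → [ m≢0 , c≢0 ]′ (ℕₚ.m*n≡0⇒m≡0∨n≡0 m eq))) ⟩
    b                   ≡⟨ ÷₀-* b (ι≢0 m m≢0) ⟨
    (b ÷₀ ι m) * ι m    ≡⟨ ℚₚ.*-comm (b ÷₀ ι m) (ι m) ⟩
    ι m * (b ÷₀ ι m)    ∎)
    where
    open ≡-Reasoning
    y = b ÷₀ ι (m ℕ.* c)

  module _ {m} (2≤m : 2 ≤ m) where

    private
      B/[m*[m-1]]≡ : ι (m ∸ 1) * (B m ÷₀ ι (m ℕ.* (m ∸ 1))) ≡ B/ m
      B/[m*[m-1]]≡ = ÷₀-÷₀ (B m) m (m ∸ 1) (ℕₚ.>⇒≢ (ℕₚ.<⇒≤ 2≤m)) (ℕₚ.>⇒≢ (ℕₚ.∸-monoˡ-≤ 1 2≤m))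

    Q-∣ : ∀ {N} → N ≢ 0 → Q m ≡ ι N → N ∣ m ∸ 1
    Q-∣ = ratio-∣ (m ∸ 1) B/[m*[m-1]]≡

    Q-maximal : ∀ {N} → N ≢ 0 → Q m ≡ ι N → ∀ {q e} → Prime q → ¬ (q ∣ N) → q ∣ e →
      m ∸ 1 ≡ N ℕ.* e → ¬ (q ∣num B/ m)
    Q-maximal = ratio-maximal (m ∸ 1) B/[m*[m-1]]≡

    Q≡ : ∀ {N e} → N ≢ 0 → ∣ ↥ B/ m ∣ ≢ 0 → N ∣num B/ m → m ∸ 1 ≡ N ℕ.* e →
      Coprime ∣ ↥ B/ m ∣ e → Q m ≡ ι N
    Q≡ = ratio≡ (m ∸ 1) B/[m*[m-1]]≡

  -- Irregular pairs

  2∣⇒2∤pred : ∀ {n} → n ≢ 0 → 2 ∣ n → ¬ (2 ∣ n ∸ 1)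
  2∣⇒2∤pred {zero}  n≢0 _   _      = n≢0 refl
  2∣⇒2∤pred {suc n} _   2∣n 2∣n-1 =
    p∤1 prime[2] (∣m+n∣m⇒∣n (subst (2 ∣_) (ℕₚ.+-comm 1 n) 2∣n) 2∣n-1)

  2∤⇒2∣pred : ∀ n → ¬ (2 ∣ n) → 2 ∣ n ∸ 1
  2∤⇒2∣pred zero          2∤n = 2 ∣0
  2∤⇒2∣pred (suc zero)    2∤n = 2 ∣0
  2∤⇒2∣pred (suc (suc n)) 2∤n with n
  ... | zero   = contradiction ∣-refl 2∤n
  ... | suc n′ = ∣m∣n⇒∣m+n ∣-refl (2∤⇒2∣pred (suc n′) (λ 2∣n → 2∤n (∣m∣n⇒∣m+n ∣-refl 2∣n)))

  oddPrime⇒2< : ∀ {q} → OddPrime q → 2 < q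
  oddPrime⇒2< {q} (pr , 2∤q) = ℕₚ.≤∧≢⇒< (ℕ.nonTrivial⇒n>1 q {{prime⇒nonTrivial pr}}) λ { refl → 2∤q ∣-refl }

  module _ {q : ℕ} (odd : OddPrime q) where

    private
      pr : Prime q
      pr = proj₁ odd
      instance
        q≢0 : ℕ.NonZero q
        q≢0 = prime⇒nonZero pr
        q-1≢0 : ℕ.NonZero (q ∸ 1)
        q-1≢0 = ℕ.>-nonZero (ℕₚ.∸-monoˡ-≤ 1 (ℕₚ.<⇒≤ (oddPrime⇒2< odd)))

    q∣num⇒∈ : ∀ x → q ∣num x → x ∈ q ℤ₍ q ₎
    q∣num⇒∈ x = ∣num⇒∈ pr ∣-refl

    ∈⇒q∣num : ∀ x → x ∈ q ℤ₍ q ₎ → q ∣num x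
    ∈⇒q∣num x x∈ = subst (_∣num x) (ℕₚ.*-identityʳ q) (∈⇒∣num pr 1 (subst (x ∈_ℤ₍ q ₎) (sym (ℕₚ.*-identityʳ q)) x∈))

    -- 0 < l < q - 1 makes l a unit at q, so B_l may be replaced by B_l/l, and rules out q - 1 ∣ l;
    -- Kummer then covers the progression.
    irregularPair⇒∣B/ : ∀ {l} → IrregularPair q l → ∀ k → q ∣num B/ (l ℕ.+ (q ∸ 1) ℕ.* k)
    irregularPair⇒∣B/ {l} irr k = ∈⇒q∣num (B/ (l ℕ.+ (q ∸ 1) ℕ.* k))
      (Equivalence.to (kummer-mod-p pr l k (lower irr) q-1∤l) B/∈)
      where
      open IrregularPair using (lower; upper)
      l≢0 : l ≢ 0
      l≢0 = ℕₚ.>⇒≢ (ℕₚ.<⇒≤ (lower irr))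
      instance _ = ℕ.≢-nonZero l≢0
      l<q-1 : l < q ∸ 1
      l<q-1 = ℕₚ.≤-<-trans (upper irr) (ℕₚ.∸-monoʳ-< {q} (ℕ.s<s ℕ.z<s) (oddPrime⇒2< odd))
      q-1∤l : ¬ (q ∸ 1 ∣ l)
      q-1∤l = >⇒∤ l<q-1
      B/∈ : B/ l ∈ q ℤ₍ q ₎
      B/∈ = ∈-cancel-unit pr {u = l} {x = B/ l} (>⇒∤ (ℕₚ.<-≤-trans l<q-1 (ℕₚ.m∸n≤m q 1)))
        (subst (_∈ q ℤ₍ q ₎) (trans (sym (÷₀-* (B l) (ι≢0 l l≢0))) (ℚₚ.*-comm (B/ l) (ι l)))
            (q∣num⇒∈ (B l) (IrregularPair.divides irr)))

    -- l is the residue of m modulo q - 1: nonzero by von Staudt, and even because m and q - 1 are.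
    ∣B/⇒irregularPair : ∀ m → m ≢ 0 → 2 ∣ m → q ∣num B/ m →
      ∃[ l ] IrregularPair q l × ∃[ k ] m ≡ l ℕ.+ (q ∸ 1) ℕ.* k
    ∣B/⇒irregularPair m m≢0 2∣m q∣B/m = l , record
      { oddPrime = odd
      ; even     = 2∣l
      ; lower    = 2≤l
      ; upper    = l≤q-3
      ; divides  = ∈⇒q∣num (B l)
          (subst (_∈ q ℤ₍ q ₎) (÷₀-* (B l) (ι≢0 l l≢0)) (∈-*ʳ pr {x = B/ l} {y = ι l} B/l∈ (ι-∈ pr l)))
      } , k , m≡
      where
      l k : ℕ
      l = m ℕ/.% (q ∸ 1)
      k = m ℕ/./ (q ∸ 1)
      m≡ : m ≡ l ℕ.+ (q ∸ 1) ℕ.* k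
      m≡ = trans (ℕ/.m≡m%n+[m/n]*n m (q ∸ 1)) (cong (l ℕ.+_) (ℕₚ.*-comm k (q ∸ 1)))
      B/m∈ : B/ m ∈ q ℤ₍ q ₎
      B/m∈ = q∣num⇒∈ (B/ m) q∣B/m
      q-1∤m : ¬ (q ∸ 1 ∣ m)
      q-1∤m (divides zero    m≡0) = m≢0 m≡0
      q-1∤m (divides (suc j) m≡j) = B/-∉ pr (oddPrime⇒2< odd) j
        (subst (λ i → B/ i ∈ 1 ℤ₍ q ₎) (trans m≡j (cong ((q ∸ 1) ℕ.+_) (ℕₚ.*-comm j (q ∸ 1))))
            (∈-weaken pr (1∣ q) B/m∈))
      l≢0 : l ≢ 0
      l≢0 l≡0 = q-1∤m (m%n≡0⇒n∣m m (q ∸ 1) l≡0)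
      2∣q-1 : 2 ∣ q ∸ 1
      2∣q-1 = 2∤⇒2∣pred q (proj₂ odd)
      2∣l : 2 ∣ l
      2∣l = %-presˡ-∣ 2∣m 2∣q-1
      2≤l : 2 ≤ l
      2≤l = ∣⇒≤ {{ℕ.≢-nonZero l≢0}} 2∣l
      l<q-1 : l < q ∸ 1
      l<q-1 = ℕ/.m%n<n m (q ∸ 1)
      l≤q-3 : l ≤ q ∸ 3
      -- l < q - 1 leaves only l = q - 2 to exclude, which is odd.
      l≤q-3 = subst (l ≤_) (ℕₚ.∸-+-assoc q 2 1) (ℕₚ.<⇒≤pred (ℕₚ.≤∧≢⇒<
        (subst (l ≤_) (ℕₚ.∸-+-assoc q 1 1) (ℕₚ.<⇒≤pred l<q-1))
        λ l≡ → 2∣⇒2∤pred (ℕ.≢-nonZero⁻¹ (q ∸ 1)) 2∣q-1 (subst (2 ∣_) (trans l≡ (sym (ℕₚ.∸-+-assoc q 1 1))) 2∣l)))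
      B/l∈ : B/ l ∈ q ℤ₍ q ₎
      B/l∈ = Equivalence.from
          (kummer-mod-p pr l k 2≤l (λ q-1∣l → q-1∤m (subst (q ∸ 1 ∣_) (sym m≡) (∣m∣n⇒∣m+n q-1∣l (m∣m*n k)))))
        (subst (λ i → B/ i ∈ q ℤ₍ q ₎) m≡ B/m∈)

  ∣B/-periodic : ∀ {p} → Prime p → ∀ r m k → suc r < m → ¬ (p ∸ 1 ∣ m) →
    p ^ suc r ∣num B/ m → p ^ suc r ∣num B/ (m ℕ.+ p ^ r ℕ.* (p ∸ 1) ℕ.* k)
  ∣B/-periodic {p} pr r m k r<m p-1∤m p∣ = ∈⇒∣num pr (suc r) {B/ (m ℕ.+ p ^ r ℕ.* (p ∸ 1) ℕ.* k)}
    (Equivalence.to (kummer pr r m k r<m p-1∤m) (∣num⇒∈ pr {x = B/ m} (m∣m*n (p ^ r)) p∣))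

open import Data.Nat.Base using (ℕ; suc; _+_; _*_; _∸_; _^_; _≤_)
open import Data.Product.Base using (∃; _×_)
open import Data.Sum.Base using (_⊎_)
open import Data.Vec.Base using (Vec; _∷_; head; replicate)
open import Function.Bundles using (_⇔_)
open import Relation.Nullary using (¬_)

-- Euler's function and digit expansions

-- φ with the range of counting separated from the modulus, so that induction on the range is
-- possible.
totatives : ℕ → ℕ → ℕ
totatives N n = length (filter (coprime? N) (applyUpTo suc n))

totatives-suc : ∀ N n → totatives N (suc n) ≡ totatives N n + length (filter (coprime? N) (suc n ∷ []))
totatives-suc N n = begin
  totatives N (suc n)
      ≡⟨ cong (length ∘ filter P?) (applyUpTo-∷ʳ suc n) ⟨
  length (filter P? (applyUpTo suc n ∷ʳ suc n))
      ≡⟨ cong length (filter-++ P? (applyUpTo suc n) (suc n ∷ [])) ⟩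
  length (filter P? (applyUpTo suc n) ++ filter P? (suc n ∷ [])) ≡⟨ length-++ (filter P? (applyUpTo suc n)) ⟩
  totatives N n + length (filter P? (suc n ∷ []))                      ∎
  where
  open ≡-Reasoning
  P? = coprime? N

totatives-coprime : ∀ N n → Coprime N (suc n) → totatives N (suc n) ≡ suc (totatives N n)
totatives-coprime N n c = trans (totatives-suc N n)
  (trans (cong (λ xs → totatives N n + length xs) (filter-accept (coprime? N) {xs = []} c))
      (ℕₚ.+-comm (totatives N n) 1))

totatives-¬coprime : ∀ N n → ¬ Coprime N (suc n) → totatives N (suc n) ≡ totatives N n
totatives-¬coprime N n ¬c = trans (totatives-suc N n)
  (trans (cong (λ xs → totatives N n + length xs) (filter-reject (coprime? N) {xs = []} ¬c))
      (ℕₚ.+-identityʳ (totatives N n)))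

module _ {p} (pr : Prime p) where

  private
    instance
      p≢0 : ℕ.NonZero p
      p≢0 = prime⇒nonZero pr

    suc[p-1] : suc (p ∸ 1) ≡ p
    suc[p-1] = ℕₚ.suc-pred p

  ∤⇒^-coprime : ∀ k {d} → ¬ (p ∣ d) → Coprime (p ^ k) d
  ∤⇒^-coprime zero    p∤d (c∣1 , _) = ∣1⇒≡1 c∣1
  ∤⇒^-coprime (suc k) p∤d = coprime-*ˡ (∤⇒coprime pr p∤d) (∤⇒^-coprime k p∤d)

  ∣⇒¬^-coprime : ∀ k {d} → p ∣ d → ¬ Coprime (p ^ suc k) d
  ∣⇒¬^-coprime k p∣d c = ¬prime[1] (subst Prime (c (m∣m*n (p ^ k) , p∣d)) pr)

  -- Counting in blocks of length p: each of the t full blocks loses only its last element, the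
  -- multiple of p, and the j further numbers are all prime to p.
  totatives-^ : ∀ k t j → j ≤ p ∸ 1 → totatives (p ^ suc k) (t * p + j) ≡ t * (p ∸ 1) + j
  totatives-^ k t (suc j) j<p = begin
    totatives (p ^ suc k) (t * p + suc j)     ≡⟨ cong (totatives (p ^ suc k)) (ℕₚ.+-suc (t * p) j) ⟩
    totatives (p ^ suc k) (suc (t * p + j))   ≡⟨ totatives-coprime (p ^ suc k) (t * p + j) (∤⇒^-coprime (suc k) p∤) ⟩
    suc (totatives (p ^ suc k) (t * p + j))   ≡⟨ cong suc (totatives-^ k t j (ℕₚ.<⇒≤ j<p)) ⟩
    suc (t * (p ∸ 1) + j)                     ≡⟨ ℕₚ.+-suc (t * (p ∸ 1)) j ⟨
    t * (p ∸ 1) + suc j                       ∎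
    where
    open ≡-Reasoning
    p∤ : ¬ (p ∣ suc (t * p + j))
    p∤ p∣ = >⇒∤ (subst (suc j <_) suc[p-1] (s≤s j<p))
      (∣m+n∣m⇒∣n (subst (p ∣_) (sym (ℕₚ.+-suc (t * p) j)) p∣) (n∣m*n t))
  totatives-^ k zero    zero _ = refl
  totatives-^ k (suc t) zero _ = begin
    totatives (p ^ suc k) (suc t * p + 0)          ≡⟨ cong (totatives (p ^ suc k)) index ⟩
    totatives (p ^ suc k) (suc (t * p + (p ∸ 1)))
        ≡⟨ totatives-¬coprime (p ^ suc k) (t * p + (p ∸ 1))
            (∣⇒¬^-coprime k (subst (p ∣_) index (∣m∣n⇒∣m+n (n∣m*n (suc t)) (p ∣0)))) ⟩
    totatives (p ^ suc k) (t * p + (p ∸ 1))        ≡⟨ totatives-^ k t (p ∸ 1) ℕₚ.≤-refl ⟩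
    t * (p ∸ 1) + (p ∸ 1)                          ≡⟨ ℕₚ.+-comm (t * (p ∸ 1)) (p ∸ 1) ⟩
    suc t * (p ∸ 1)                                ≡⟨ ℕₚ.+-identityʳ (suc t * (p ∸ 1)) ⟨
    suc t * (p ∸ 1) + 0                            ∎
    where
    open ≡-Reasoning
    index : suc t * p + 0 ≡ suc (t * p + (p ∸ 1))
    index = begin
      suc t * p + 0           ≡⟨ ℕₚ.+-identityʳ (suc t * p) ⟩
      p + t * p               ≡⟨ ℕₚ.+-comm p (t * p) ⟩
      t * p + p               ≡⟨ cong (t * p +_) suc[p-1] ⟨
      t * p + suc (p ∸ 1)     ≡⟨ ℕₚ.+-suc (t * p) (p ∸ 1) ⟩
      suc (t * p + (p ∸ 1))   ∎

  φ-^ : ∀ k → φ (p ^ suc k) ≡ p ^ k * (p ∸ 1)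
  φ-^ k = begin
    totatives (p ^ suc k) (p ^ suc k)        ≡⟨ cong (totatives (p ^ suc k))
        (trans (ℕₚ.*-comm p (p ^ k)) (sym (ℕₚ.+-identityʳ (p ^ k * p)))) ⟩
    totatives (p ^ suc k) (p ^ k * p + 0)    ≡⟨ totatives-^ k (p ^ k) 0 z≤n ⟩
    p ^ k * (p ∸ 1) + 0                      ≡⟨ ℕₚ.+-identityʳ (p ^ k * (p ∸ 1)) ⟩
    p ^ k * (p ∸ 1)                          ∎
    where open ≡-Reasoning

horner : ∀ {n} → ℕ → Vec ℕ n → ℕ
horner p []       = 0
horner p (d ∷ ds) = d + p * horner p ds

-- The scalar c absorbs the powers of p: passing to the tail replaces c by cp.
sum-horner : ∀ p c {n} (ds : Vec ℕ n) →
  Vec.sum (tabulate λ i → lookup ds i * (c * p ^ toℕ i)) ≡ c * horner p ds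
sum-horner p c []       = sym (ℕₚ.*-zeroʳ c)
sum-horner p c (d ∷ ds) = begin
  d * (c * 1) + Vec.sum (tabulate λ i → lookup ds i * (c * (p * p ^ toℕ i)))
    ≡⟨ cong (λ t → d * (c * 1) + Vec.sum t)
        (tabulate-cong λ i → cong (lookup ds i *_) (sym (ℕₚ.*-assoc c p (p ^ toℕ i)))) ⟩
  d * (c * 1) + Vec.sum (tabulate λ i → lookup ds i * (c * p * p ^ toℕ i))
    ≡⟨ cong (d * (c * 1) +_) (sum-horner p (c * p) ds) ⟩
  d * (c * 1) + c * p * horner p ds
    ≡⟨ solve 4 (λ d c p h → d :* (c :* con 1) :+ c :* p :* h := c :* (d :+ p :* h)) refl d c p (horner p ds) ⟩
  c * horner p (d ∷ ds) ∎
  where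
  open ≡-Reasoning
  open ℕ-Solver using (solve; _:=_; _:+_; _:*_; con)

-- The weights are 1, p - 1, (p - 1)p, (p - 1)p², ...; after the first digit they are p - 1 times
-- those of an ordinary base p expansion.
expand-horner : ∀ {p} → Prime p → ∀ {n} s₁ (ds : Vec ℕ n) → expand p (s₁ ∷ ds) ≡ s₁ + (p ∸ 1) * horner p ds
expand-horner {p} pr s₁ ds = cong₂ _+_ (ℕₚ.*-identityʳ s₁)
  (trans (cong Vec.sum (tabulate-cong λ i → cong (lookup ds i *_)
      (trans (φ-^ pr (toℕ i)) (ℕₚ.*-comm (p ^ toℕ i) (p ∸ 1)))))
    (sum-horner p (p ∸ 1) ds))

-- Modulo p = p′ + 1 the expression is c - d for the first digit d, so d = c. Then c + p′c = pc, and
-- cancelling p leaves an expression of the same shape with one digit fewer.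
constant-digits : ∀ p′ {c} → c < suc p′ → ∀ {n} (ds : Vec ℕ n) → (∀ i → lookup ds i < suc p′) →
  suc p′ ^ n ∣ c + p′ * horner (suc p′) ds →
  ds ≡ replicate n c × c + p′ * horner (suc p′) ds ≡ c * suc p′ ^ n
constant-digits p′ {c} c<p [] _ _ = refl , trans (cong (c +_) (ℕₚ.*-zeroʳ p′))
    (trans (ℕₚ.+-identityʳ c) (sym (ℕₚ.*-identityʳ c)))
constant-digits p′ {c} c<p {suc n} (d ∷ ds) d<p pⁿ⁺¹∣ =
  cong₂ _∷_ (sym c≡d) (proj₁ IH) , (begin
    c + p′ * (d + p * T)    ≡⟨ factored ⟩
    p * (c + p′ * T)        ≡⟨ cong (p *_) (proj₂ IH) ⟩
    p * (c * p ^ n)         ≡⟨ solve 3 (λ p c q → p :* (c :* q) := c :* (p :* q)) refl p c (p ^ n) ⟩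
    c * p ^ suc n           ∎)
  where
  open ≡-Reasoning
  open ℕ-Solver using (solve; _:=_; _:+_; _:*_; con)
  p T : ℕ
  p = suc p′
  T = horner p ds
  p∣c+p′d : p ∣ c + p′ * d
  p∣c+p′d = ∣m+n∣m⇒∣n
    (subst (p ∣_) (solve 4
        (λ c p′ d T → c :+ p′ :* (d :+ (con 1 :+ p′) :* T) := (con 1 :+ p′) :* (p′ :* T) :+
            (c :+ p′ :* d)) refl c p′ d T)
      (∣-trans (m∣m*n (p ^ n)) pⁿ⁺¹∣))
    (m∣m*n (p′ * T))
  c≡d : c ≡ d
  c≡d with p∣c+p′d
  ... | divides q eq = begin
    c                  ≡⟨ ℕ/.m<n⇒m%n≡m c<p ⟨
    c ℕ/.% p           ≡⟨ ℕ/.[m+kn]%n≡m%n c d p ⟨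
    (c + d * p) ℕ/.% p ≡⟨ cong (ℕ/._% p) (begin
        c + d * p          ≡⟨ solve 3 (λ c p′ d → c :+ d :* (con 1 :+ p′) := d :+ (c :+ p′ :* d)) refl c p′ d ⟩
        d + (c + p′ * d)   ≡⟨ cong (d +_) eq ⟩
        d + q * p          ∎) ⟩
    (d + q * p) ℕ/.% p ≡⟨ ℕ/.[m+kn]%n≡m%n d q p ⟩
    d ℕ/.% p           ≡⟨ ℕ/.m<n⇒m%n≡m (d<p fzero) ⟩
    d                  ∎
  factored : c + p′ * (d + p * T) ≡ p * (c + p′ * T)
  factored = trans (cong (λ d → c + p′ * (d + p * T)) (sym c≡d))
    (solve 3 (λ c p′ T → c :+ p′ :* (c :+ (con 1 :+ p′) :* T) := (con 1 :+ p′) :* (c :+ p′ :* T)) refl c p′ T)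
  IH : ds ≡ replicate n c × c + p′ * T ≡ c * p ^ n
  IH = constant-digits p′ c<p ds (d<p ∘ fsuc) (*-cancelˡ-∣ p (subst (p ^ suc n ∣_) factored pⁿ⁺¹∣))

-- c + kp′ ≡ c - k modulo p = p′ + 1. For k < c this residue lies strictly between 0 and p, so k ≥
-- c, and k = c gives cp.
smallest-multiple : ∀ p′ {c} → c < suc p′ → ∀ k → suc p′ ∣ c + k * p′ → c * suc p′ ≤ c + k * p′
smallest-multiple p′ {c} c<p k p∣ with ℕₚ.≤-total c k
... | inj₁ c≤k = subst (_≤ c + k * p′) (sym (ℕₚ.*-suc c p′)) (ℕₚ.+-monoʳ-≤ c (ℕₚ.*-monoˡ-≤ p′ c≤k))
... | inj₂ k≤c with c ∸ k in c-k≡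
...   | zero  = subst (_≤ c + k * p′) (sym (ℕₚ.*-suc c p′))
    (ℕₚ.+-monoʳ-≤ c (ℕₚ.*-monoˡ-≤ p′ (ℕₚ.m∸n≡0⇒m≤n {c} {k} c-k≡)))
...   | suc e = contradiction
    (∣m+n∣m⇒∣n (subst (suc p′ ∣_) (begin
        c + k * p′              ≡⟨ cong (_+ k * p′) (trans (sym (ℕₚ.m+[n∸m]≡n k≤c)) (cong (k +_) c-k≡)) ⟩
        k + suc e + k * p′      ≡⟨ solve 3 (λ k e p′ → k :+ e :+ k :* p′ := k :* (con 1 :+ p′) :+ e) refl k (suc e) p′ ⟩
        k * suc p′ + suc e      ∎) p∣) (n∣m*n k))
    (>⇒∤ (ℕₚ.≤-<-trans (subst (_≤ c) c-k≡ (ℕₚ.m∸n≤m c k)) c<p))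
  where
  open ≡-Reasoning
  open ℕ-Solver using (solve; _:=_; _:+_; _:*_; con)

prime-factor : ∀ n → 2 ≤ n → ∃[ q ] Prime q × q ∣ n
prime-factor n 2≤n with factorise n {{ℕ.>-nonZero (ℕₚ.<⇒≤ 2≤n)}}
... | record { factors = [] ; isFactorisation = n≡1 } = contradiction n≡1 (ℕₚ.>⇒≢ 2≤n)
... | record { factors = q ∷ qs ; isFactorisation = n≡ ; factorsPrime = q-prime ∷ _ } =
  q , q-prime , subst (q ∣_) (sym n≡) (m∣m*n _)

coprime-by-primes : ∀ {m n} → n ≢ 0 → (∀ q → Prime q → q ∣ n → ¬ (q ∣ m)) → Coprime m n
coprime-by-primes n≢0 no-common {zero}          (_ , 0∣n)   = contradiction (0∣⇒≡0 0∣n) n≢0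
coprime-by-primes n≢0 no-common {suc zero}      _           = refl
coprime-by-primes n≢0 no-common {d@(suc (suc _))} (d∣m , d∣n) =
  let q , q-prime , q∣d = prime-factor d (s≤s (s≤s z≤n))
  in contradiction (∣-trans q∣d d∣m) (no-common q q-prime (∣-trans q∣d d∣n))

n<p^n : ∀ {p} → 2 ≤ p → ∀ n → n < p ^ n
n<p^n 2≤p zero    = s≤s z≤n
n<p^n {p} 2≤p (suc n) = begin-strict
  suc n                 ≤⟨ n<p^n 2≤p n ⟩
  p ^ n                 <⟨ ℕₚ.m<m*n (p ^ n) p {{ℕ.>-nonZero (ℕₚ.≤-<-trans z≤n (n<p^n 2≤p n))}} 2≤p ⟩
  p ^ n * p             ≡⟨ ℕₚ.*-comm (p ^ n) p ⟩
  p ^ suc n             ∎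
  where open ℕₚ.≤-Reasoning

-- Solutions of Q(m) = p^r in the progression of l_r modulo φ(p^r).

module _ {r′ p′ l lᵣ} {ds : Vec ℕ r′} (irregular : IrregularPair (suc p′) l)
         (associated : AssociatedPair (suc p′) lᵣ (l ∷ ds)) where

  private
    r p c : ℕ
    r = suc r′
    p = suc p′
    c = l ∸ 1

    module l = IrregularPair irregular
    module A = AssociatedPair associated
    module lᵣ = IrregularPairOfOrder A.pair

    pr : Prime p
    pr = proj₁ l.oddPrime

    p^r≢0 : p ^ r ≢ 0
    p^r≢0 eq = contradiction (ℕₚ.m^n≡0⇒m≡0 p r eq) λ ()

    1≤l : 1 ≤ l
    1≤l = ℕₚ.<⇒≤ l.lower

    c+1≡l : suc c ≡ l
    c+1≡l = ℕₚ.m+[n∸m]≡n 1≤l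

    c≢0 : c ≢ 0
    c≢0 = ℕₚ.>⇒≢ (ℕₚ.∸-monoˡ-≤ 1 l.lower)

    l<p-1 : l < p′
    l<p-1 = ℕₚ.≤-<-trans l.upper (ℕₚ.∸-monoʳ-< {p′} {2} {0} ℕ.z<s (ℕₚ.≤-pred (oddPrime⇒2< l.oddPrime)))

    c<p : c < p
    c<p = ℕₚ.<-trans (subst (c <_) c+1≡l (ℕₚ.n<1+n c)) (ℕₚ.m<n⇒m<1+n l<p-1)

    -- Every weight after the first is a multiple of p - 1, so l_r ≡ l, and 0 < l < p - 1.
    p-1∤lᵣ : ¬ (p′ ∣ lᵣ)
    p-1∤lᵣ p-1∣ = >⇒∤ {{ℕ.>-nonZero 1≤l}} l<p-1
      (∣m+n∣m⇒∣n (subst (p′ ∣_)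
          (trans (trans A.expansion (expand-horner pr l ds)) (ℕₚ.+-comm l (p′ * horner p ds))) p-1∣)
        (m∣m*n (horner p ds)))

    lᵣ-1≡ : lᵣ ∸ 1 ≡ c + p′ * horner p ds
    lᵣ-1≡ = trans (cong (_∸ 1) (trans A.expansion (expand-horner pr l ds))) (ℕₚ.+-∸-comm (p′ * horner p ds) 1≤l)

    member-∸1 : ∀ {m} k → m ≡ lᵣ + k * φ (p ^ r) → m ∸ 1 ≡ (lᵣ ∸ 1) + k * (p ^ r′ * p′)
    member-∸1 k m≡ = trans (cong (_∸ 1) (trans m≡ (cong (λ t → lᵣ + k * t) (φ-^ pr r′))))
      (ℕₚ.+-∸-comm (k * (p ^ r′ * p′)) (ℕₚ.<⇒≤ lᵣ.lower))

    member-∣ : ∀ {m} → ASet p r lᵣ m → p ^ r ∣ m ∸ 1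
    member-∣ {m} ((k , m≡) , Qm) = Q-∣ {m} (subst (2 ≤_) (sym m≡) (ℕₚ.m≤n⇒m≤n+o (k * φ (p ^ r)) lᵣ.lower)) p^r≢0 Qm

  solution⇒digits : ∃ (ASet p r lᵣ) → l ∷ ds ≡ l ∷ replicate r′ (l ∸ 1) × lᵣ ∸ 1 ≡ (l ∸ 1) * p ^ (r ∸ 1)
  solution⇒digits (m , m∈@((k , m≡) , _)) =
    let ds≡ , value≡ = constant-digits p′ c<p ds (A.digits ∘ fsuc) (subst (p ^ r′ ∣_) lᵣ-1≡ p^r′∣lᵣ-1)
    in cong (l ∷_) ds≡ , trans lᵣ-1≡ value≡
    where
    p^r′∣lᵣ-1 : p ^ r′ ∣ lᵣ ∸ 1
    p^r′∣lᵣ-1 = ∣m+n∣m⇒∣n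
      (subst (p ^ r′ ∣_) (trans (member-∸1 k m≡) (ℕₚ.+-comm (lᵣ ∸ 1) (k * (p ^ r′ * p′))))
          (∣-trans (n∣m*n p) (member-∣ m∈)))
      (∣n⇒∣m*n k (m∣m*n p′))

  -- The candidate M = (l - 1)p^r + 1 and the condition for it to be a solution.

  module _ (lᵣ-1≡cp^r′ : lᵣ ∸ 1 ≡ c * p ^ r′) where

    private
      open ≡-Reasoning
      open ℕ-Solver using (solve; _:=_; _:+_; _:*_; con)

      M : ℕ
      M = c * p ^ r + 1

      M-1≡ : M ∸ 1 ≡ c * p ^ r
      M-1≡ = ℕₚ.m+n∸n≡m (c * p ^ r) 1

      -- M is the member k = c of the progression: c p^r - c p^(r-1) = c φ(p^r).
      M≡lᵣ+ : M ≡ lᵣ + p ^ r′ * p′ * c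
      M≡lᵣ+ = begin
        c * (p * p ^ r′) + 1             ≡⟨ solve 3
            (λ c p′ q → c :* ((con 1 :+ p′) :* q) :+ con 1 := con 1 :+ c :* q :+ q :* p′ :* c) refl c p′ (p ^ r′) ⟩
        1 + c * p ^ r′ + p ^ r′ * p′ * c ≡⟨ cong (λ t → 1 + t + p ^ r′ * p′ * c) lᵣ-1≡cp^r′ ⟨
        1 + (lᵣ ∸ 1) + p ^ r′ * p′ * c   ≡⟨ cong (_+ p ^ r′ * p′ * c) (ℕₚ.m+[n∸m]≡n (ℕₚ.<⇒≤ lᵣ.lower)) ⟩
        lᵣ + p ^ r′ * p′ * c             ∎

      index≡ : (lᵣ ∸ 1) * p + 1 ≡ M
      index≡ = cong (_+ 1) (trans (cong (_* p) lᵣ-1≡cp^r′)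
        (trans (ℕₚ.*-assoc c (p ^ r′) p) (cong (c *_) (ℕₚ.*-comm (p ^ r′) p))))

      2≤M : 2 ≤ M
      2≤M = subst (2 ≤_) (sym M≡lᵣ+) (ℕₚ.m≤n⇒m≤n+o (p ^ r′ * p′ * c) lᵣ.lower)

      M≢0 : M ≢ 0
      M≢0 = ℕₚ.>⇒≢ (ℕₚ.<⇒≤ 2≤M)

      2∣M : 2 ∣ M
      2∣M = subst (2 ∣_) (sym M≡lᵣ+) (∣m∣n⇒∣m+n lᵣ.even (∣m⇒∣m*n c (∣n⇒∣m*n (p ^ r′) (2∤⇒2∣pred p (proj₂ l.oddPrime)))))

    -- A member satisfies m - 1 = p^(r-1)(c + k(p - 1)). As p^r divides m - 1, p divides the
    -- bracket, which is therefore at least cp.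
    minimal : ∀ m → ASet p r lᵣ m → M ≤ m
    minimal m m∈@((k , m≡) , _) = subst₂ _≤_ (ℕₚ.+-comm 1 (c * p ^ r)) (ℕₚ.m+[n∸m]≡n 1≤m)
      (s≤s (subst₂ _≤_ (solve 3 (λ c p q → q :* (c :* p) := c :* (p :* q)) refl c p (p ^ r′)) (sym m-1≡)
        (ℕₚ.*-monoʳ-≤ (p ^ r′) (smallest-multiple p′ c<p k p∣))))
      where
      1≤m : 1 ≤ m
      1≤m = subst (1 ≤_) (sym m≡) (ℕₚ.m≤n⇒m≤n+o (k * φ (p ^ r)) (ℕₚ.<⇒≤ lᵣ.lower))
      m-1≡ : m ∸ 1 ≡ p ^ r′ * (c + k * p′)
      m-1≡ = trans (member-∸1 k m≡) (trans (cong (_+ k * (p ^ r′ * p′)) lᵣ-1≡cp^r′)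
        (solve 4 (λ c q k p′ → c :* q :+ k :* (q :* p′) := q :* (c :+ k :* p′)) refl c (p ^ r′) k p′))
      p∣ : p ∣ c + k * p′
      p∣ = *-cancelˡ-∣ (p ^ r′) {{ℕₚ.m^n≢0 p r′}} (subst₂ _∣_ (ℕₚ.*-comm p (p ^ r′)) m-1≡ (member-∣ m∈))

    private
      p^r∣B/M : p ^ r ∣num B/ M
      p^r∣B/M = subst (λ j → p ^ r ∣num B/ j) (sym M≡lᵣ+) (∣B/-periodic pr r′ lᵣ c r<lᵣ p-1∤lᵣ lᵣ.divides)
        where
        -- Kummer modulo p^r requires an index above r; here l_r = 1 + c p^(r-1) and p^(r-1) ≥ r.
        r<lᵣ : r < lᵣ
        r<lᵣ = subst (r <_) (ℕₚ.m+[n∸m]≡n (ℕₚ.<⇒≤ lᵣ.lower)) (s≤s (subst (r ≤_) (sym lᵣ-1≡cp^r′)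
          (ℕₚ.≤-trans (n<p^n (ℕₚ.<⇒≤ (oddPrime⇒2< l.oddPrime)) r′) (ℕₚ.m≤n*m (p ^ r′) c {{ℕ.≢-nonZero c≢0}}))))

      divisor-odd : ∀ {q} → Prime q → q ∣ c → OddPrime q
      divisor-odd q-prime q∣c = q-prime , λ 2∣q → 2∣⇒2∤pred (ℕₚ.>⇒≢ 1≤l) l.even (∣-trans 2∣q q∣c)

      M≡⇒congruent : ∀ q l′ j → 1 ≤ l′ → M ≡ l′ + (q ∸ 1) * j → c * p ^ r ≡ l′ ∸ 1 [mod q ∸ 1 ]
      M≡⇒congruent q l′ j 1≤l′ M≡ = subst (q ∸ 1 ∣_) (sym (begin
        ∣ c * p ^ r - (l′ ∸ 1) ∣
            ≡⟨ cong (λ t → ∣ t - (l′ ∸ 1) ∣)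
                (trans (sym M-1≡) (trans (cong (_∸ 1) M≡) (ℕₚ.+-∸-comm ((q ∸ 1) * j) 1≤l′))) ⟩
        ∣ (l′ ∸ 1) + (q ∸ 1) * j - (l′ ∸ 1) ∣            ≡⟨ ℕₚ.∣-∣-comm ((l′ ∸ 1) + (q ∸ 1) * j) (l′ ∸ 1) ⟩
        ∣ l′ ∸ 1 - (l′ ∸ 1) + (q ∸ 1) * j ∣              ≡⟨ ℕₚ.∣m-m+n∣≡n (l′ ∸ 1) ((q ∸ 1) * j) ⟩
        (q ∸ 1) * j                                      ∎)) (m∣m*n j)

      -- The congruence is stated through an absolute difference; l′ ≤ c p^r fixes its sign, so M
      -- lies above l′ and the number of steps is natural.
      congruent⇒M≡ : ∀ q l′ → 1 ≤ l′ → l′ ≤ c * p ^ r → c * p ^ r ≡ l′ ∸ 1 [mod q ∸ 1 ] → ∃[ j ] M ≡ l′ + (q ∸ 1) * j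
      congruent⇒M≡ q l′ 1≤l′ l′≤ (divides j eq) = j , (begin
        c * p ^ r + 1                                 ≡⟨ ℕₚ.+-comm (c * p ^ r) 1 ⟩
        suc (c * p ^ r)                               ≡⟨ cong suc (ℕₚ.m+[n∸m]≡n l′-1≤) ⟨
        suc ((l′ ∸ 1) + (c * p ^ r ∸ (l′ ∸ 1)))
            ≡⟨ cong₂ _+_ (ℕₚ.m+[n∸m]≡n 1≤l′)
                (trans (sym (ℕₚ.m≤n⇒∣m-n∣≡n∸m l′-1≤)) (trans (ℕₚ.∣-∣-comm (l′ ∸ 1) (c * p ^ r)) eq)) ⟩
        l′ + j * (q ∸ 1)                              ≡⟨ cong (l′ +_) (ℕₚ.*-comm j (q ∸ 1)) ⟩
        l′ + (q ∸ 1) * j                              ∎)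
        where
        l′-1≤ : l′ ∸ 1 ≤ c * p ^ r
        l′-1≤ = ℕₚ.≤-trans (ℕₚ.m∸n≤m l′ 1) l′≤

    NoCongruence : Set
    NoCongruence = ∀ q → Irregular q → q ∣ c → ∀ l′ → IrregularPair q l′ → ¬ (c * p ^ r ≡ l′ ∸ 1 [mod q ∸ 1 ])

    -- A prime q ∣ c satisfies q ≤ c < p, so it is prime to p^r and divides the cofactor c of p^r in
    -- M - 1; a congruence would make it divide the numerator of B_M/M as well.
    Q-M⇒noCongruence : Q M ≡ ι (p ^ r) → NoCongruence
    Q-M⇒noCongruence QM q _ q∣c l′ irr′ congruent =
      let j , M≡ = congruent⇒M≡ q l′ 1≤l′ l′≤ congruent
      in Q-maximal 2≤M p^r≢0 QM q-prime q∤p^r q∣c (trans M-1≡ (ℕₚ.*-comm c (p ^ r)))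
           (subst (λ i → q ∣num B/ i) (sym M≡) (irregularPair⇒∣B/ l′.oddPrime irr′ j))
      where
      module l′ = IrregularPair irr′
      q-prime : Prime q
      q-prime = proj₁ l′.oddPrime
      1≤l′ : 1 ≤ l′
      1≤l′ = ℕₚ.<⇒≤ l′.lower
      q≤c : q ≤ c
      q≤c = ∣⇒≤ {{ℕ.≢-nonZero c≢0}} q∣c
      l′≤ : l′ ≤ c * p ^ r
      l′≤ = ℕₚ.≤-trans (ℕₚ.≤-trans l′.upper (ℕₚ.≤-trans (ℕₚ.m∸n≤m q 3) q≤c)) (ℕₚ.m≤m*n c (p ^ r) {{ℕₚ.m^n≢0 p r}})
      q∤p^r : ¬ (q ∣ p ^ r)
      q∤p^r q∣p^r with prime⇒irreducible pr (∣-prime-^ q-prime r q∣p^r)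
      ... | inj₁ q≡1 = ¬prime[1] (subst Prime q≡1 q-prime)
      ... | inj₂ q≡p = ℕₚ.<-irrefl q≡p (ℕₚ.≤-<-trans q≤c c<p)

    noCongruence⇒Q-M : NoCongruence → Q M ≡ ι (p ^ r)
    noCongruence⇒Q-M noCongruence = Q≡ 2≤M p^r≢0 numerator≢0 p^r∣B/M (trans M-1≡ (ℕₚ.*-comm c (p ^ r)))
      (coprime-by-primes c≢0 no-common)
      where
      no-common : ∀ q → Prime q → q ∣ c → ¬ (q ∣num B/ M)
      no-common q q-prime q∣c q∣B/M =
        let l′ , irr′ , j , M≡ = ∣B/⇒irregularPair (divisor-odd q-prime q∣c) M M≢0 2∣M q∣B/M
        in noCongruence q (l′ , irr′) q∣c l′ irr′ (M≡⇒congruent q l′ j (ℕₚ.<⇒≤ (IrregularPair.lower irr′)) M≡)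
      l≢2 : l ≢ 2
      -- B₂ = 1/6 has numerator 1.
      l≢2 refl = p∤1 pr l.divides
      2≤c : 2 ≤ c
      2≤c = ℕₚ.∸-monoˡ-≤ 1 (ℕₚ.≤∧≢⇒< l.lower (λ 2≡l → l≢2 (sym 2≡l)))
      -- A zero numerator would be divisible by a prime factor of c, which `no-common` forbids.
      numerator≢0 : ℤ.∣ ↥ B/ M ∣ ≢ 0
      numerator≢0 eq =
        let q , q-prime , q∣c = prime-factor c 2≤c
        in no-common q q-prime q∣c (subst (q ∣_) (sym eq) (q ∣0))

    -- Without irregular prime factors `NoCongruence` holds vacuously, so both cases reduce to it;
    -- minimality and the equality of the two forms of M are already available.
    characterisation : (IsA p r lᵣ ((lᵣ ∸ 1) * p + 1) × (lᵣ ∸ 1) * p + 1 ≡ (l ∸ 1) * p ^ r + 1)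
      ⇔ (NoIrregularPrimeFactors (l ∸ 1) ⊎ NoCongruence)
    characterisation = mk⇔
      (λ { (((_ , QM) , _) , _) → inj₂ (Q-M⇒noCongruence (subst (λ m → Q m ≡ ι (p ^ r)) index≡ QM)) })
      (λ cases → (((c , trans index≡
          (trans M≡lᵣ+ (cong (lᵣ +_) (trans (ℕₚ.*-comm (p ^ r′ * p′) c) (cong (c *_) (sym (φ-^ pr r′))))))) ,
                    subst (λ m → Q m ≡ ι (p ^ r)) (sym index≡) (noCongruence⇒Q-M (noCongruence cases))) ,
                   (λ m m∈ → subst (_≤ m) (sym index≡) (minimal m m∈))) , index≡)
      where
      noCongruence : NoIrregularPrimeFactors c ⊎ NoCongruence → NoCongruence
      noCongruence (inj₁ none) q q-irr q∣c = contradiction q∣c (none q q-irr)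
      noCongruence (inj₂ holds)            = holds

theorem3p3 : (r′ : ℕ) → let r = suc r′ in
    (p l Δ : ℕ) → IrregularPair p l → IsΔ p l Δ → Δ ≢ 0 →
    (lᵣ : ℕ) (s : Vec ℕ r) → AssociatedPair p lᵣ s → head s ≡ l →
    (∃ (ASet p r lᵣ) → s ≡ l ∷ replicate r′ (l ∸ 1) × lᵣ ∸ 1 ≡ (l ∸ 1) * p ^ (r ∸ 1))
    ×
    (s ≡ l ∷ replicate r′ (l ∸ 1) × lᵣ ∸ 1 ≡ (l ∸ 1) * p ^ (r ∸ 1) →
      ((IsA p r lᵣ ((lᵣ ∸ 1) * p + 1) × (lᵣ ∸ 1) * p + 1 ≡ (l ∸ 1) * p ^ r + 1)
        ⇔
        (NoIrregularPrimeFactors (l ∸ 1)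
         ⊎ (∀ q → Irregular q → q ∣ l ∸ 1 → ∀ l′ → IrregularPair q l′ → ¬ ((l ∸ 1) * p ^ r ≡ l′ ∸ 1 [mod q ∸ 1 ]))))
      × (∀ a → IsA p r lᵣ a → (l ∸ 1) * p ^ r + 1 ≤ a))
theorem3p3 r′ zero     l Δ irregular _ _ _ _ _ _ =
  contradiction (proj₁ (IrregularPair.oddPrime irregular)) ¬prime[0]
theorem3p3 r′ (suc p′) l Δ irregular _ _ lᵣ (.l ∷ ds) associated refl =
  solution⇒digits irregular associated ,
  λ { (_ , lᵣ-1≡) → characterisation irregular associated lᵣ-1≡ ,
                    λ { a (a∈ , _) → minimal irregular associated lᵣ-1≡ a a∈ } }
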